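{- For every $n\in\omega$ and every sequent $\Gamma\Rightarrow\Delta$ of first-order arithmetic: if $\Gamma\Rightarrow\Delta$ has a $\mathrm{CPA}$-proof in which every bud and every companion is labelled by a sequent all of whose formulas are $\Pi_n$ formulas, then $\Gamma\Rightarrow\Delta$ has a $\mathrm{PA}$-proof in which every instance of the induction axioms is on a $\Pi_{n+1}$ formula.
   Context: Language of first-order arithmetic: terms from variables, $0,S,+,\cdot$; formulas from $s=t,\bot,\wedge,\vee,\to,\forall,\exists$; $\Pi_n$ is the usual arithmetical hierarchy class. Sequents $\Gamma\Rightarrow\Delta$ consist of finite sets of formulas. $\mathrm{PA}$: classical multi-conclusion sequent calculus with the standard classical first-order rules with equality, weakening, cut, arithmetic axioms $\Rightarrow 0\neq St$, $Ss=St\Rightarrow s=t$, $\Rightarrow s+0=s$, $\Rightarrow s+St=S(s+t)$, $\Rightarrow s\cdot 0=0$, $\Rightarrow s\cdot St=(s\cdot t)+s$, and induction axioms $\varphi(0),\forall x.\,\varphi(x)\to\varphi(Sx)\Rightarrow\varphi(s)$; proofs are finite trees. $\mathrm{CPA}$: rules of $\mathrm{PA}$ without induction axioms plus $\textsc{Case}_x$ (from $\Gamma[0/x]\Rightarrow\Delta[0/x]$ and $\Gamma[Sx/x]\Rightarrow\Delta[Sx/x]$ infer $\Gamma\Rightarrow\Delta$). Pre-proofs are finite trees with a partial map $\beta$ sending some leaves (buds) to inner nodes (companions), non-bud nodes labelled by rule instances whose premises label the children, each bud carrying its companion's sequent. An infinite branch starts at the root and each step goes to a child or from a bud to its companion.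 A $\mathrm{CPA}$-proof is a pre-proof such that along every infinite branch some variable $x$ is, from some point on, free in every sequent of the branch and the branch passes instances of $\textsc{Case}_x$ infinitely often. -}

module Defs where

open import Data.Nat using (ℕ; zero; suc; _≤_; _≟_)
open import Data.Fin using (Fin; zero; suc)
open import Data.List using (List; []; _∷_; [_]; _++_; map)
open import Data.List.Relation.Unary.All using (All; []; _∷_)
open import Data.List.Relation.Binary.Pointwise using (Pointwise)
open import Data.List.Relation.Binary.Subset.Propositional using (_⊆_)
open import Data.List.Relation.Unary.Any using (Any)
open import Data.Maybe using (Maybe; just; nothing)
open import Data.Product using (Σ; _×_; _,_; proj₁)
open import Data.Sum using (_⊎_)
open import Data.Empty using (⊥)
open import Data.Unit using (⊤)
open import Relation.Nullary using (¬_; yes; no)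
open import Relation.Binary.PropositionalEquality using (_≡_)

-- Syntax (locally nameless): bound variables are de Bruijn indices in
-- Fin n (n = number of enclosing binders), free variables are names ℕ.

data Term (n : ℕ) : Set where
  bv   : Fin n → Term n
  fv   : ℕ → Term n
  `0   : Term n
  `S   : Term n → Term n
  _`+_ : Term n → Term n → Term n
  _`·_ : Term n → Term n → Term n

data Formula (n : ℕ) : Set where
  _≐_  : Term n → Term n → Formula n
  `⊥   : Formula n
  _`∧_ : Formula n → Formula n → Formula n
  _`∨_ : Formula n → Formula n → Formula n
  _`→_ : Formula n → Formula n → Formula n
  `∀   : Formula (suc n) → Formula n
  `∃   : Formula (suc n) → Formula n

renT : ∀ {m n} → (Fin m → Fin n) → Term m → Term n
renT ρ (bv i) = bv (ρ i)
renT ρ (fv x) = fv x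
renT ρ `0 = `0
renT ρ (`S t) = `S (renT ρ t)
renT ρ (s `+ t) = renT ρ s `+ renT ρ t
renT ρ (s `· t) = renT ρ s `· renT ρ t

wkT : ∀ {n} → Term n → Term (suc n)
wkT = renT suc

substT : ∀ {m n} → (Fin m → Term n) → Term m → Term n
substT σ (bv i) = σ i
substT σ (fv x) = fv x
substT σ `0 = `0
substT σ (`S t) = `S (substT σ t)
substT σ (s `+ t) = substT σ s `+ substT σ t
substT σ (s `· t) = substT σ s `· substT σ t

liftσ : ∀ {m n} → (Fin m → Term n) → Fin (suc m) → Term (suc n)
liftσ σ zero = bv zero
liftσ σ (suc i) = wkT (σ i)

substF : ∀ {m n} → (Fin m → Term n) → Formula m → Formula n
substF σ (s ≐ t) = substT σ s ≐ substT σ t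
substF σ `⊥ = `⊥
substF σ (φ `∧ ψ) = substF σ φ `∧ substF σ ψ
substF σ (φ `∨ ψ) = substF σ φ `∨ substF σ ψ
substF σ (φ `→ ψ) = substF σ φ `→ substF σ ψ
substF σ (`∀ φ) = `∀ (substF (liftσ σ) φ)
substF σ (`∃ φ) = `∃ (substF (liftσ σ) φ)

_⟨_⟩ : Formula 1 → Term 0 → Formula 0
φ ⟨ t ⟩ = substF (λ _ → t) φ

stepF : Formula 1 → Formula 1
stepF φ = substF (λ _ → `S (bv zero)) φ

wk0 : ∀ {n} → Term 0 → Term n
wk0 = renT (λ ())

fsubT : ∀ {n} → ℕ → Term 0 → Term n → Term n
fsubT x u (bv i) = bv i
fsubT x u (fv y) with x ≟ y
... | yes _ = wk0 u
... | no  _ = fv y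
fsubT x u `0 = `0
fsubT x u (`S t) = `S (fsubT x u t)
fsubT x u (s `+ t) = fsubT x u s `+ fsubT x u t
fsubT x u (s `· t) = fsubT x u s `· fsubT x u t

fsubF : ∀ {n} → ℕ → Term 0 → Formula n → Formula n
fsubF x u (s ≐ t) = fsubT x u s ≐ fsubT x u t
fsubF x u `⊥ = `⊥
fsubF x u (φ `∧ ψ) = fsubF x u φ `∧ fsubF x u ψ
fsubF x u (φ `∨ ψ) = fsubF x u φ `∨ fsubF x u ψ
fsubF x u (φ `→ ψ) = fsubF x u φ `→ fsubF x u ψ
fsubF x u (`∀ φ) = `∀ (fsubF x u φ)
fsubF x u (`∃ φ) = `∃ (fsubF x u φ)

FreeT : ∀ {n} → ℕ → Term n → Set
FreeT x (bv i) = ⊥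
FreeT x (fv y) = x ≡ y
FreeT x `0 = ⊥
FreeT x (`S t) = FreeT x t
FreeT x (s `+ t) = FreeT x s ⊎ FreeT x t
FreeT x (s `· t) = FreeT x s ⊎ FreeT x t

FreeF : ∀ {n} → ℕ → Formula n → Set
FreeF x (s ≐ t) = FreeT x s ⊎ FreeT x t
FreeF x `⊥ = ⊥
FreeF x (φ `∧ ψ) = FreeF x φ ⊎ FreeF x ψ
FreeF x (φ `∨ ψ) = FreeF x φ ⊎ FreeF x ψ
FreeF x (φ `→ ψ) = FreeF x φ ⊎ FreeF x ψ
FreeF x (`∀ φ) = FreeF x φ
FreeF x (`∃ φ) = FreeF x φ

leF : ∀ {n} → Term n → Term n → Formula n
leF s t = `∃ ((wkT s `+ bv zero) ≐ wkT t)

data Delta0 : ∀ {n} → Formula n → Set where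
  d-eq  : ∀ {n} (s t : Term n) → Delta0 (s ≐ t)
  d-bot : ∀ {n} → Delta0 {n} `⊥
  d-and : ∀ {n} {φ ψ : Formula n} → Delta0 φ → Delta0 ψ → Delta0 (φ `∧ ψ)
  d-or  : ∀ {n} {φ ψ : Formula n} → Delta0 φ → Delta0 ψ → Delta0 (φ `∨ ψ)
  d-imp : ∀ {n} {φ ψ : Formula n} → Delta0 φ → Delta0 ψ → Delta0 (φ `→ ψ)
  d-ball : ∀ {n} (t : Term n) {φ : Formula (suc n)} → Delta0 φ →
           Delta0 (`∀ (leF (bv zero) (wkT t) `→ φ))
  d-bex  : ∀ {n} (t : Term n) {φ : Formula (suc n)} → Delta0 φ →
           Delta0 (`∃ (leF (bv zero) (wkT t) `∧ φ))

data Pi : ℕ → ∀ {n} → Formula n → Set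
data Sigma : ℕ → ∀ {n} → Formula n → Set

data Pi where
  pi-d0  : ∀ {n} {φ : Formula n} → Delta0 φ → Pi 0 φ
  pi-sig : ∀ {k n} {φ : Formula n} → Sigma k φ → Pi (suc k) φ
  pi-all : ∀ {k n} {φ : Formula (suc n)} → Pi (suc k) φ → Pi (suc k) (`∀ φ)

data Sigma where
  sig-d0 : ∀ {n} {φ : Formula n} → Delta0 φ → Sigma 0 φ
  sig-pi : ∀ {k n} {φ : Formula n} → Pi k φ → Sigma (suc k) φ
  sig-ex : ∀ {k n} {φ : Formula (suc n)} → Sigma (suc k) φ → Sigma (suc k) (`∃ φ)

-- Sequents: finite sets of formulas, represented by lists up to _≋_.

Sequent : Set
Sequent = List (Formula 0) × List (Formula 0)

_≈ₗ_ : List (Formula 0) → List (Formula 0) → Set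
Γ ≈ₗ Γ' = (Γ ⊆ Γ') × (Γ' ⊆ Γ)

_≋_ : Sequent → Sequent → Set
(Γ , Δ) ≋ (Γ' , Δ') = (Γ ≈ₗ Γ') × (Δ ≈ₗ Δ')

FreeSeq : ℕ → Sequent → Set
FreeSeq x (Γ , Δ) = Any (FreeF x) Γ ⊎ Any (FreeF x) Δ

AllPi : ℕ → Sequent → Set
AllPi n (Γ , Δ) = All (Pi n) Γ × All (Pi n) Δ

substSeq : ℕ → Term 0 → Sequent → Sequent
substSeq x u (Γ , Δ) = map (fsubF x u) Γ , map (fsubF x u) Δ

-- Rule schemata (on lists; "Γ, φ" is φ ∷ Γ).  Rule instances of the
-- set-based calculus are obtained by closing under _≋_ (see Inst).

Rules : Set₁
Rules = Sequent → List Sequent → Set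

data BaseRule : Rules where
  ax    : ∀ {Γ Δ} (φ : Formula 0) → BaseRule (φ ∷ Γ , φ ∷ Δ) []
  botL  : ∀ {Γ Δ} → BaseRule (`⊥ ∷ Γ , Δ) []
  eqR   : ∀ {Γ Δ} (t : Term 0) → BaseRule (Γ , (t ≐ t) ∷ Δ) []
  eqL   : ∀ {Γ Δ} (x : ℕ) (φ : Formula 0) (s t : Term 0) →
          BaseRule ((s ≐ t) ∷ fsubF x s φ ∷ Γ , fsubF x t φ ∷ Δ) []
  andL  : ∀ {Γ Δ} (φ ψ : Formula 0) →
          BaseRule ((φ `∧ ψ) ∷ Γ , Δ) [ (φ ∷ ψ ∷ Γ , Δ) ]
  andR  : ∀ {Γ Δ} (φ ψ : Formula 0) →
          BaseRule (Γ , (φ `∧ ψ) ∷ Δ) ((Γ , φ ∷ Δ) ∷ (Γ , ψ ∷ Δ) ∷ [])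
  orL   : ∀ {Γ Δ} (φ ψ : Formula 0) →
          BaseRule ((φ `∨ ψ) ∷ Γ , Δ) ((φ ∷ Γ , Δ) ∷ (ψ ∷ Γ , Δ) ∷ [])
  orR   : ∀ {Γ Δ} (φ ψ : Formula 0) →
          BaseRule (Γ , (φ `∨ ψ) ∷ Δ) [ (Γ , φ ∷ ψ ∷ Δ) ]
  impL  : ∀ {Γ Δ} (φ ψ : Formula 0) →
          BaseRule ((φ `→ ψ) ∷ Γ , Δ) ((Γ , φ ∷ Δ) ∷ (ψ ∷ Γ , Δ) ∷ [])
  impR  : ∀ {Γ Δ} (φ ψ : Formula 0) →
          BaseRule (Γ , (φ `→ ψ) ∷ Δ) [ (φ ∷ Γ , ψ ∷ Δ) ]
  allL  : ∀ {Γ Δ} (φ : Formula 1) (t : Term 0) →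
          BaseRule (`∀ φ ∷ Γ , Δ) [ (φ ⟨ t ⟩ ∷ Γ , Δ) ]
  allR  : ∀ {Γ Δ} (φ : Formula 1) (y : ℕ) → ¬ FreeSeq y (Γ , `∀ φ ∷ Δ) →
          BaseRule (Γ , `∀ φ ∷ Δ) [ (Γ , φ ⟨ fv y ⟩ ∷ Δ) ]
  exL   : ∀ {Γ Δ} (φ : Formula 1) (y : ℕ) → ¬ FreeSeq y (`∃ φ ∷ Γ , Δ) →
          BaseRule (`∃ φ ∷ Γ , Δ) [ (φ ⟨ fv y ⟩ ∷ Γ , Δ) ]
  exR   : ∀ {Γ Δ} (φ : Formula 1) (t : Term 0) →
          BaseRule (Γ , `∃ φ ∷ Δ) [ (Γ , φ ⟨ t ⟩ ∷ Δ) ]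
  wk    : ∀ {Γ Δ} (Γ' Δ' : List (Formula 0)) →
          BaseRule (Γ ++ Γ' , Δ ++ Δ') [ (Γ , Δ) ]
  cut   : ∀ {Γ Δ} (φ : Formula 0) →
          BaseRule (Γ , Δ) ((Γ , φ ∷ Δ) ∷ (φ ∷ Γ , Δ) ∷ [])
  ar-zs : (t : Term 0) → BaseRule ([] , [ (`0 ≐ `S t) `→ `⊥ ]) []
  ar-ss : (s t : Term 0) → BaseRule ([ `S s ≐ `S t ] , [ s ≐ t ]) []
  ar-p0 : (s : Term 0) → BaseRule ([] , [ (s `+ `0) ≐ s ]) []
  ar-pS : (s t : Term 0) → BaseRule ([] , [ (s `+ `S t) ≐ `S (s `+ t) ]) []
  ar-m0 : (s : Term 0) → BaseRule ([] , [ (s `· `0) ≐ `0 ]) []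
  ar-mS : (s t : Term 0) → BaseRule ([] , [ (s `· `S t) ≐ ((s `· t) `+ s) ]) []

data PARule (P : Formula 1 → Set) : Rules where
  base : ∀ {c ps} → BaseRule c ps → PARule P c ps
  ind  : (φ : Formula 1) (s : Term 0) → P φ →
         PARule P (φ ⟨ `0 ⟩ ∷ `∀ (φ `→ stepF φ) ∷ [] , [ φ ⟨ s ⟩ ]) []

data CPARule : Rules where
  base : ∀ {c ps} → BaseRule c ps → CPARule c ps
  case : ∀ {S} (x : ℕ) →
         CPARule S (substSeq x `0 S ∷ substSeq x (`S (fv x)) S ∷ [])

record Inst (R : Rules) (c : Sequent) (ps : List Sequent) : Set where
  constructor inst
  field
    c'   : Sequent
    ps'  : List Sequent
    rule : R c' ps'
    c≋   : c ≋ c'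
    ps≋  : Pointwise _≋_ ps ps'

data Proof (R : Rules) : Sequent → Set where
  by : ∀ {c ps} → Inst R c ps → All (Proof R) ps → Proof R c

PAProof : ℕ → Sequent → Set
PAProof k = Proof (PARule (Pi k))

-- CPA pre-proofs: finite trees whose leaves are either 0-premise rule
-- instances or buds; a bud stores the address (path from the root) of
-- its companion.

data PreTree : Sequent → Set where
  bud  : ∀ {c} → List ℕ → PreTree c
  node : ∀ {c ps} → Inst CPARule c ps → All PreTree ps → PreTree c

Node : Set
Node = Σ Sequent PreTree

mutual
  sub : ∀ {c} → PreTree c → List ℕ → Maybe Node
  sub {c} t [] = just (c , t)
  sub (bud _) (_ ∷ _) = nothing
  sub (node _ ts) (j ∷ a) = subAll ts j a

  subAll : ∀ {ps} → All PreTree ps → ℕ → List ℕ → Maybe Node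
  subAll [] j a = nothing
  subAll (t ∷ ts) zero a = sub t a
  subAll (t ∷ ts) (suc j) a = subAll ts j a

OnJust : (Node → Set) → Maybe Node → Set
OnJust P m = Σ Node λ e → (m ≡ just e) × P e

IsInner : Node → Set
IsInner (_ , bud _) = ⊥
IsInner (_ , node _ _) = ⊤

BudTo : List ℕ → Node → Set
BudTo b (_ , bud b') = b' ≡ b
BudTo b (_ , node _ _) = ⊥

CompanionOf : Sequent → Node → Set
CompanionOf c (c' , bud _) = ⊥
CompanionOf c (c' , node _ _) = c ≋ c'

BudsOK : ∀ {S} → PreTree S → Set
BudsOK t = ∀ a c b → sub t a ≡ just (c , bud b) → OnJust (CompanionOf c) (sub t b)

Step : ∀ {S} → PreTree S → List ℕ → List ℕ → Set
Step t a a' =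
  (Σ ℕ λ j → (a' ≡ a ++ [ j ]) × OnJust IsInner (sub t a) × OnJust (λ _ → ⊤) (sub t a'))
  ⊎ OnJust (BudTo a') (sub t a)

InfBranch : ∀ {S} → PreTree S → (ℕ → List ℕ) → Set
InfBranch t a = (a 0 ≡ []) × (∀ i → Step t (a i) (a (suc i)))

IsCaseRule : ℕ → ∀ {c ps} → CPARule c ps → Set
IsCaseRule x (base _) = ⊥
IsCaseRule x (case y) = x ≡ y

IsCaseNode : ℕ → Node → Set
IsCaseNode x (_ , bud _) = ⊥
IsCaseNode x (_ , node i _) = IsCaseRule x (Inst.rule i)

GoodBranch : ∀ {S} → PreTree S → (ℕ → List ℕ) → Set
GoodBranch t a = Σ ℕ λ x → Σ ℕ λ k →
  (∀ i → k ≤ i → OnJust (λ e → FreeSeq x (proj₁ e)) (sub t (a i))) ×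
  (∀ m → Σ ℕ λ i → (m ≤ i) × OnJust (IsCaseNode x) (sub t (a i)))

CPAProof : Sequent → Set
CPAProof S = Σ (PreTree S) λ t → BudsOK t × (∀ a → InfBranch t a → GoodBranch t a)

BudsCompanionsPi : ℕ → ∀ {S} → CPAProof S → Set
BudsCompanionsPi n (t , _) = ∀ a c b → sub t a ≡ just (c , bud b) →
  AllPi n c × OnJust (λ e → AllPi n (proj₁ e)) (sub t b)

{-# OPTIONS --safe #-}
module Submission where

-- View the pre-proof as a finite graph whose vertices are the addresses of its
-- nodes. By induction on the size of a set U of vertices: if the names rebound
-- in U (eigenvariables and case variables) are not free in Φ, and PA proves from
-- Φ every sequent on an edge leaving U, then it proves from Φ every sequent in U.
-- If U has a sink or is not strongly connected, treat the parts in turn.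
-- Otherwise run through U for ever: the trace variable x of this infinite branch
-- is free everywhere in U, and some vertex of U is a case distinction on x. Let
-- I(a) say that the bud sequents of U hold for all x < a and all values of the
-- other names rebound in U. A boolean combination of Π_n formulas has a Π_{n+1}
-- prenex form, so I may be proved by Π_{n+1} induction on a. For the step, pass
-- to the hypotheses Φ, I(a), x ≤ a. Case distinctions on x now leave U: in the
-- left premise x is not free, and in the right one x < a, so that following the
-- tree down to its buds reduces the sequent to I(a). Without these vertices U is
-- smaller and the induction hypothesis applies.

-- Only the bud sequents are known to be simple; cuts make the formulas at other vertices
-- arbitrarily complex. Hence `I(a)` speaks of buds alone. On the way down to them eigenvariables
-- and other case variables change their values, so `I(a)` binds all of these universally. With the
-- antecedents, which enter negated as Σ_n formulas, this costs exactly one level.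
--
-- The hypotheses `Φ` serve nested loops. A loop inside what is left of `U` has its own trace
-- variable and its own induction, during which `I(a)` and `x ≤ a` must stay fixed. They do: `I(a)`
-- binds every name rebound in `U`, and `x` is no longer rebound, since its case distinctions are
-- gone and no eigenvariable in `U` can be `x`, which is free in every conclusion.
--
-- Two bounds are needed: `I(0)` holds for want of an `x < 0`, while `I(a + 1)` asks for `x ≤ a`.
-- Both are written as equations with a fresh witness `z`, bound in `I` like the other names, so
-- that the guard is quantifier-free and fits even `n = 0`.

open import Defs
open import Data.Empty using (⊥-elim)
open import Data.Fin using (Fin; suc; zero)
open import Data.List using (List; []; [_]; _++_; _∷_; concatMap; filter; length; map; upTo)
open import Data.List.Membership.Propositional using (_∈_; _∉_; find; lose)
open import Data.List.Membership.Propositional.Properties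
  using (∈-++⁺ʳ; ∈-++⁺ˡ; ∈-++⁻; ∈-concatMap⁺; ∈-concatMap⁻; ∈-filter⁺; ∈-filter⁻; ∈-map⁺; ∈-map⁻; ∈-upTo⁺; ∈-upTo⁻)
open import Data.List.Properties using (++-assoc; ++-identityʳ; filter-notAll; map-++; ≡-dec)
open import Data.List.Relation.Binary.Pointwise using (Pointwise; []; _∷_)
open import Data.List.Relation.Binary.Subset.Propositional using (_⊆_)
open import Data.List.Relation.Binary.Subset.Propositional.Properties
  using (++⁺ʳ; ++⁺ˡ; Any-resp-⊆; xs⊆ys++xs; ∷⁺ʳ)
open import Data.List.Relation.Unary.All as All using (All; []; _∷_; all?)
open import Data.List.Relation.Unary.All.Properties as All using (All¬⇒¬Any; ¬All⇒Any¬)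
open import Data.List.Relation.Unary.Any as Any using (Any; any?; here; there)
import Data.List.Relation.Unary.Any.Properties as Any
open import Data.Maybe using (Maybe; just; maybe′; nothing)
open import Data.Nat using (_+_; _<_; _≟_; _≤_; suc; s≤s; zero; z≤n; ℕ)
open import Data.Nat.ListAction using (sum)
open import Data.Nat.Properties
  using (+-identityʳ; +-suc; <⇒≢; m≤m+n; m≤n+m; m≤n⇒∃[o]m+o≡n; ≤-pred; ≤-refl; ≤-trans)
open import Data.Product using (_,_; _×_; proj₁; proj₂; Σ; ∃)
open import Data.Sum using ([_,_]′; _⊎_; inj₁; inj₂)
open import Data.Unit using (tt)
open import Function using (_∘_; id)
open import Level using (0ℓ)
open import Relation.Binary using (Decidable; DecidableEquality; Rel)
open import Relation.Binary.Construct.Closure.ReflexiveTransitive using (Star; _◅_; _◅◅_; reverse; ε)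
open import Relation.Binary.PropositionalEquality
  using (_≡_; _≢_; cong; cong₂; refl; subst; subst₂; sym; trans)
open import Relation.Nullary using (Dec; no; yes; ¬?; ¬_)
open import Relation.Nullary.Decidable using (_×-dec_)

-- Substitution

private variable
  l m n : ℕ

-- Simultaneous substitution for names and indices; renT, substF, fsubF and
-- the abstraction of a name are all instances, so one fusion law serves all.

ssubT : (ℕ → Term n) → (Fin m → Term n) → Term m → Term n
ssubT τ σ (bv i) = σ i
ssubT τ σ (fv x) = τ x
ssubT τ σ `0 = `0
ssubT τ σ (`S t) = `S (ssubT τ σ t)
ssubT τ σ (s `+ t) = ssubT τ σ s `+ ssubT τ σ t
ssubT τ σ (s `· t) = ssubT τ σ s `· ssubT τ σ t

ssubF : (ℕ → Term n) → (Fin m → Term n) → Formula m → Formula n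
ssubF τ σ (s ≐ t) = ssubT τ σ s ≐ ssubT τ σ t
ssubF τ σ `⊥ = `⊥
ssubF τ σ (φ `∧ ψ) = ssubF τ σ φ `∧ ssubF τ σ ψ
ssubF τ σ (φ `∨ ψ) = ssubF τ σ φ `∨ ssubF τ σ ψ
ssubF τ σ (φ `→ ψ) = ssubF τ σ φ `→ ssubF τ σ ψ
ssubF τ σ (`∀ φ) = `∀ (ssubF (wkT ∘ τ) (liftσ σ) φ)
ssubF τ σ (`∃ φ) = `∃ (ssubF (wkT ∘ τ) (liftσ σ) φ)

liftσ-cong : {σ σ' : Fin m → Term n} → (∀ i → σ i ≡ σ' i) → ∀ i → liftσ σ i ≡ liftσ σ' i
liftσ-cong e zero = refl
liftσ-cong e (suc i) = cong wkT (e i)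

-- Names need to agree only where they occur. Compared with the identity, this gives invariance
-- under substitution for a name that is not free.
ssubT-cong : {τ τ' : ℕ → Term n} {σ σ' : Fin m → Term n} (t : Term m) →
          (∀ x → FreeT x t → τ x ≡ τ' x) → (∀ i → σ i ≡ σ' i) → ssubT τ σ t ≡ ssubT τ' σ' t
ssubT-cong (bv i) e f = f i
ssubT-cong (fv x) e f = e x refl
ssubT-cong `0 e f = refl
ssubT-cong (`S t) e f = cong `S (ssubT-cong t e f)
ssubT-cong (s `+ t) e f = cong₂ _`+_ (ssubT-cong s (λ x → e x ∘ inj₁) f) (ssubT-cong t (λ x → e x ∘ inj₂) f)
ssubT-cong (s `· t) e f = cong₂ _`·_ (ssubT-cong s (λ x → e x ∘ inj₁) f) (ssubT-cong t (λ x → e x ∘ inj₂) f)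

ssubF-cong : {τ τ' : ℕ → Term n} {σ σ' : Fin m → Term n} (φ : Formula m) →
          (∀ x → FreeF x φ → τ x ≡ τ' x) → (∀ i → σ i ≡ σ' i) → ssubF τ σ φ ≡ ssubF τ' σ' φ
ssubF-cong (s ≐ t) e f = cong₂ _≐_ (ssubT-cong s (λ x → e x ∘ inj₁) f) (ssubT-cong t (λ x → e x ∘ inj₂) f)
ssubF-cong `⊥ e f = refl
ssubF-cong (φ `∧ ψ) e f = cong₂ _`∧_ (ssubF-cong φ (λ x → e x ∘ inj₁) f) (ssubF-cong ψ (λ x → e x ∘ inj₂) f)
ssubF-cong (φ `∨ ψ) e f = cong₂ _`∨_ (ssubF-cong φ (λ x → e x ∘ inj₁) f) (ssubF-cong ψ (λ x → e x ∘ inj₂) f)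
ssubF-cong (φ `→ ψ) e f = cong₂ _`→_ (ssubF-cong φ (λ x → e x ∘ inj₁) f) (ssubF-cong ψ (λ x → e x ∘ inj₂) f)
ssubF-cong (`∀ φ) e f = cong `∀ (ssubF-cong φ (λ x → cong wkT ∘ e x) (liftσ-cong f))
ssubF-cong (`∃ φ) e f = cong `∃ (ssubF-cong φ (λ x → cong wkT ∘ e x) (liftσ-cong f))

ssubT-id : (t : Term n) → ssubT fv bv t ≡ t
ssubT-id (bv i) = refl
ssubT-id (fv x) = refl
ssubT-id `0 = refl
ssubT-id (`S t) = cong `S (ssubT-id t)
ssubT-id (s `+ t) = cong₂ _`+_ (ssubT-id s) (ssubT-id t)
ssubT-id (s `· t) = cong₂ _`·_ (ssubT-id s) (ssubT-id t)

lift-bv : (i : Fin (suc n)) → liftσ bv i ≡ bv i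
lift-bv zero = refl
lift-bv (suc i) = refl

ssubF-id : (φ : Formula n) → ssubF fv bv φ ≡ φ
ssubF-id (s ≐ t) = cong₂ _≐_ (ssubT-id s) (ssubT-id t)
ssubF-id `⊥ = refl
ssubF-id (φ `∧ ψ) = cong₂ _`∧_ (ssubF-id φ) (ssubF-id ψ)
ssubF-id (φ `∨ ψ) = cong₂ _`∨_ (ssubF-id φ) (ssubF-id ψ)
ssubF-id (φ `→ ψ) = cong₂ _`→_ (ssubF-id φ) (ssubF-id ψ)
ssubF-id (`∀ φ) = cong `∀ (trans (ssubF-cong φ (λ _ _ → refl) lift-bv) (ssubF-id φ))
ssubF-id (`∃ φ) = cong `∃ (trans (ssubF-cong φ (λ _ _ → refl) lift-bv) (ssubF-id φ))

ssubT-fuse : (τ' : ℕ → Term n) (σ' : Fin m → Term n) (τ : ℕ → Term m) (σ : Fin l → Term m) (t : Term l) →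
          ssubT τ' σ' (ssubT τ σ t) ≡ ssubT (ssubT τ' σ' ∘ τ) (ssubT τ' σ' ∘ σ) t
ssubT-fuse τ' σ' τ σ (bv i) = refl
ssubT-fuse τ' σ' τ σ (fv x) = refl
ssubT-fuse τ' σ' τ σ `0 = refl
ssubT-fuse τ' σ' τ σ (`S t) = cong `S (ssubT-fuse τ' σ' τ σ t)
ssubT-fuse τ' σ' τ σ (s `+ t) = cong₂ _`+_ (ssubT-fuse τ' σ' τ σ s) (ssubT-fuse τ' σ' τ σ t)
ssubT-fuse τ' σ' τ σ (s `· t) = cong₂ _`·_ (ssubT-fuse τ' σ' τ σ s) (ssubT-fuse τ' σ' τ σ t)

renT≡ssubT : (ρ : Fin m → Fin n) (t : Term m) → renT ρ t ≡ ssubT fv (bv ∘ ρ) t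
renT≡ssubT ρ (bv i) = refl
renT≡ssubT ρ (fv x) = refl
renT≡ssubT ρ `0 = refl
renT≡ssubT ρ (`S t) = cong `S (renT≡ssubT ρ t)
renT≡ssubT ρ (s `+ t) = cong₂ _`+_ (renT≡ssubT ρ s) (renT≡ssubT ρ t)
renT≡ssubT ρ (s `· t) = cong₂ _`·_ (renT≡ssubT ρ s) (renT≡ssubT ρ t)

ssubT-ren : (τ : ℕ → Term n) (σ : Fin m → Term n) (ρ : Fin l → Fin m) (t : Term l) →
         ssubT τ σ (renT ρ t) ≡ ssubT τ (σ ∘ ρ) t
ssubT-ren τ σ ρ t = trans (cong (ssubT τ σ) (renT≡ssubT ρ t)) (ssubT-fuse τ σ fv (bv ∘ ρ) t)

ren-ssubT : (ρ : Fin m → Fin n) (τ : ℕ → Term m) (σ : Fin l → Term m) (t : Term l) →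
         renT ρ (ssubT τ σ t) ≡ ssubT (renT ρ ∘ τ) (renT ρ ∘ σ) t
ren-ssubT ρ τ σ (bv i) = refl
ren-ssubT ρ τ σ (fv x) = refl
ren-ssubT ρ τ σ `0 = refl
ren-ssubT ρ τ σ (`S t) = cong `S (ren-ssubT ρ τ σ t)
ren-ssubT ρ τ σ (s `+ t) = cong₂ _`+_ (ren-ssubT ρ τ σ s) (ren-ssubT ρ τ σ t)
ren-ssubT ρ τ σ (s `· t) = cong₂ _`·_ (ren-ssubT ρ τ σ s) (ren-ssubT ρ τ σ t)

ssubT-lift-wk : (τ : ℕ → Term n) (σ : Fin m → Term n) (t : Term m) →
             ssubT (wkT ∘ τ) (liftσ σ) (wkT t) ≡ wkT (ssubT τ σ t)
ssubT-lift-wk τ σ t = trans (ssubT-ren (wkT ∘ τ) (liftσ σ) suc t) (sym (ren-ssubT suc τ σ t))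

-- The composite is described by pointwise equations rather than as a function, since under a binder
-- the lifted composite agrees with the composite of the lifts only pointwise.
ssubF-fuse : {τ' : ℕ → Term n} {σ' : Fin m → Term n} {τ : ℕ → Term m} {σ : Fin l → Term m}
          {τ'' : ℕ → Term n} {σ'' : Fin l → Term n} (φ : Formula l) →
          (∀ x → ssubT τ' σ' (τ x) ≡ τ'' x) → (∀ i → ssubT τ' σ' (σ i) ≡ σ'' i) →
          ssubF τ' σ' (ssubF τ σ φ) ≡ ssubF τ'' σ'' φ
ssubF-fuse {τ' = τ'} {σ'} {τ} {σ} {τ''} {σ''} φ₀ e f = go φ₀
  where
  goT : ∀ t → ssubT τ' σ' (ssubT τ σ t) ≡ ssubT τ'' σ'' t
  goT t = trans (ssubT-fuse τ' σ' τ σ t) (ssubT-cong t (λ x _ → e x) f)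

  e↑ : ∀ x → ssubT (wkT ∘ τ') (liftσ σ') (wkT (τ x)) ≡ wkT (τ'' x)
  e↑ x = trans (ssubT-lift-wk τ' σ' (τ x)) (cong wkT (e x))

  f↑ : ∀ i → ssubT (wkT ∘ τ') (liftσ σ') (liftσ σ i) ≡ liftσ σ'' i
  f↑ zero = refl
  f↑ (suc i) = trans (ssubT-lift-wk τ' σ' (σ i)) (cong wkT (f i))

  go : ∀ φ → ssubF τ' σ' (ssubF τ σ φ) ≡ ssubF τ'' σ'' φ
  go (s ≐ t) = cong₂ _≐_ (goT s) (goT t)
  go `⊥ = refl
  go (φ `∧ ψ) = cong₂ _`∧_ (go φ) (go ψ)
  go (φ `∨ ψ) = cong₂ _`∨_ (go φ) (go ψ)
  go (φ `→ ψ) = cong₂ _`→_ (go φ) (go ψ)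
  go (`∀ φ) = cong `∀ (ssubF-fuse φ e↑ f↑)
  go (`∃ φ) = cong `∃ (ssubF-fuse φ e↑ f↑)

substT≡ssubT : (σ : Fin m → Term n) (t : Term m) → substT σ t ≡ ssubT fv σ t
substT≡ssubT σ (bv i) = refl
substT≡ssubT σ (fv x) = refl
substT≡ssubT σ `0 = refl
substT≡ssubT σ (`S t) = cong `S (substT≡ssubT σ t)
substT≡ssubT σ (s `+ t) = cong₂ _`+_ (substT≡ssubT σ s) (substT≡ssubT σ t)
substT≡ssubT σ (s `· t) = cong₂ _`·_ (substT≡ssubT σ s) (substT≡ssubT σ t)

substF≡ssubF : (σ : Fin m → Term n) (φ : Formula m) → substF σ φ ≡ ssubF fv σ φ
substF≡ssubF σ (s ≐ t) = cong₂ _≐_ (substT≡ssubT σ s) (substT≡ssubT σ t)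
substF≡ssubF σ `⊥ = refl
substF≡ssubF σ (φ `∧ ψ) = cong₂ _`∧_ (substF≡ssubF σ φ) (substF≡ssubF σ ψ)
substF≡ssubF σ (φ `∨ ψ) = cong₂ _`∨_ (substF≡ssubF σ φ) (substF≡ssubF σ ψ)
substF≡ssubF σ (φ `→ ψ) = cong₂ _`→_ (substF≡ssubF σ φ) (substF≡ssubF σ ψ)
substF≡ssubF σ (`∀ φ) = cong `∀ (substF≡ssubF (liftσ σ) φ)
substF≡ssubF σ (`∃ φ) = cong `∃ (substF≡ssubF (liftσ σ) φ)

fsub1 : ℕ → Term 0 → ℕ → Term n
fsub1 x u y = fsubT x u (fv y)

-- `fsubF` passes binders without lifting its substitution, whereas `ssubF` weakens it; the two
-- agree because `u` contains no indices.
wk-fsub1 : (x : ℕ) (u : Term 0) (y : ℕ) → wkT (fsub1 {n} x u y) ≡ fsub1 x u y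
wk-fsub1 x u y with x ≟ y
... | yes _ = trans (cong wkT (renT≡ssubT (λ ()) u))
             (trans (ren-ssubT suc fv (bv ∘ λ ()) u)
             (trans (ssubT-cong u (λ _ _ → refl) (λ ())) (sym (renT≡ssubT (λ ()) u))))
... | no _ = refl

fsubT≡ssubT : (x : ℕ) (u : Term 0) (t : Term n) → fsubT x u t ≡ ssubT (fsub1 x u) bv t
fsubT≡ssubT x u (bv i) = refl
fsubT≡ssubT x u (fv y) = refl
fsubT≡ssubT x u `0 = refl
fsubT≡ssubT x u (`S t) = cong `S (fsubT≡ssubT x u t)
fsubT≡ssubT x u (s `+ t) = cong₂ _`+_ (fsubT≡ssubT x u s) (fsubT≡ssubT x u t)
fsubT≡ssubT x u (s `· t) = cong₂ _`·_ (fsubT≡ssubT x u s) (fsubT≡ssubT x u t)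

fsubF≡ssubF : (x : ℕ) (u : Term 0) (φ : Formula n) → fsubF x u φ ≡ ssubF (fsub1 x u) bv φ
fsubF≡ssubF x u (s ≐ t) = cong₂ _≐_ (fsubT≡ssubT x u s) (fsubT≡ssubT x u t)
fsubF≡ssubF x u `⊥ = refl
fsubF≡ssubF x u (φ `∧ ψ) = cong₂ _`∧_ (fsubF≡ssubF x u φ) (fsubF≡ssubF x u ψ)
fsubF≡ssubF x u (φ `∨ ψ) = cong₂ _`∨_ (fsubF≡ssubF x u φ) (fsubF≡ssubF x u ψ)
fsubF≡ssubF x u (φ `→ ψ) = cong₂ _`→_ (fsubF≡ssubF x u φ) (fsubF≡ssubF x u ψ)
fsubF≡ssubF x u (`∀ φ) = cong `∀ (trans (fsubF≡ssubF x u φ)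
  (ssubF-cong φ (λ y _ → sym (wk-fsub1 x u y)) (sym ∘ lift-bv)))
fsubF≡ssubF x u (`∃ φ) = cong `∃ (trans (fsubF≡ssubF x u φ)
  (ssubF-cong φ (λ y _ → sym (wk-fsub1 x u y)) (sym ∘ lift-bv)))

fsub1-≢ : (x : ℕ) (u : Term 0) (y : ℕ) → x ≢ y → fsub1 {n} x u y ≡ fv y
fsub1-≢ x u y x≢y with x ≟ y
... | yes x≡y = ⊥-elim (x≢y x≡y)
... | no _ = refl

fsub1-self : (x y : ℕ) → fsub1 {n} x (fv x) y ≡ fv y
fsub1-self x y with x ≟ y
... | yes refl = refl
... | no _ = refl

fsubF-notFree : (x : ℕ) (u : Term 0) (φ : Formula n) → ¬ FreeF x φ → fsubF x u φ ≡ φ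
fsubF-notFree x u φ x∉φ = trans (fsubF≡ssubF x u φ)
  (trans (ssubF-cong φ (λ y y∈φ → fsub1-≢ x u y λ { refl → x∉φ y∈φ }) (λ _ → refl)) (ssubF-id φ))

fsubF-self : (x : ℕ) (φ : Formula n) → fsubF x (fv x) φ ≡ φ
fsubF-self x φ = trans (fsubF≡ssubF x (fv x) φ)
  (trans (ssubF-cong φ (λ y _ → fsub1-self x y) (λ _ → refl)) (ssubF-id φ))

FreeT-ren : (z : ℕ) (ρ : Fin m → Fin n) (t : Term m) → FreeT z (renT ρ t) → FreeT z t
FreeT-ren z ρ (fv x) p = p
FreeT-ren z ρ (`S t) p = FreeT-ren z ρ t p
FreeT-ren z ρ (s `+ t) (inj₁ p) = inj₁ (FreeT-ren z ρ s p)
FreeT-ren z ρ (s `+ t) (inj₂ p) = inj₂ (FreeT-ren z ρ t p)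
FreeT-ren z ρ (s `· t) (inj₁ p) = inj₁ (FreeT-ren z ρ s p)
FreeT-ren z ρ (s `· t) (inj₂ p) = inj₂ (FreeT-ren z ρ t p)

FreeT-ssubT : {z : ℕ} {τ : ℕ → Term n} {σ : Fin m → Term n} → (∀ i → ¬ FreeT z (σ i)) → (t : Term m) →
           FreeT z (ssubT τ σ t) → ∃ λ x → FreeT x t × FreeT z (τ x)
FreeT-ssubT h (bv i) p = ⊥-elim (h i p)
FreeT-ssubT h (fv x) p = x , refl , p
FreeT-ssubT h (`S t) p = FreeT-ssubT h t p
FreeT-ssubT h (s `+ t) (inj₁ p) = let x , q , r = FreeT-ssubT h s p in x , inj₁ q , r
FreeT-ssubT h (s `+ t) (inj₂ p) = let x , q , r = FreeT-ssubT h t p in x , inj₂ q , r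
FreeT-ssubT h (s `· t) (inj₁ p) = let x , q , r = FreeT-ssubT h s p in x , inj₁ q , r
FreeT-ssubT h (s `· t) (inj₂ p) = let x , q , r = FreeT-ssubT h t p in x , inj₂ q , r

FreeF-ssubF : {z : ℕ} {τ : ℕ → Term n} {σ : Fin m → Term n} → (∀ i → ¬ FreeT z (σ i)) → (φ : Formula m) →
           FreeF z (ssubF τ σ φ) → ∃ λ x → FreeF x φ × FreeT z (τ x)
FreeF-ssubF h (s ≐ t) (inj₁ p) = let x , q , r = FreeT-ssubT h s p in x , inj₁ q , r
FreeF-ssubF h (s ≐ t) (inj₂ p) = let x , q , r = FreeT-ssubT h t p in x , inj₂ q , r
FreeF-ssubF h (φ `∧ ψ) (inj₁ p) = let x , q , r = FreeF-ssubF h φ p in x , inj₁ q , r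
FreeF-ssubF h (φ `∧ ψ) (inj₂ p) = let x , q , r = FreeF-ssubF h ψ p in x , inj₂ q , r
FreeF-ssubF h (φ `∨ ψ) (inj₁ p) = let x , q , r = FreeF-ssubF h φ p in x , inj₁ q , r
FreeF-ssubF h (φ `∨ ψ) (inj₂ p) = let x , q , r = FreeF-ssubF h ψ p in x , inj₂ q , r
FreeF-ssubF h (φ `→ ψ) (inj₁ p) = let x , q , r = FreeF-ssubF h φ p in x , inj₁ q , r
FreeF-ssubF h (φ `→ ψ) (inj₂ p) = let x , q , r = FreeF-ssubF h ψ p in x , inj₂ q , r
FreeF-ssubF {z = z} {τ} {σ} h (`∀ φ) p = let x , q , r = FreeF-ssubF h↑ φ p in x , q , FreeT-ren z suc (τ x) r
  where
  h↑ : ∀ i → ¬ FreeT z (liftσ σ i)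
  h↑ (suc i) r = h i (FreeT-ren z suc (σ i) r)
FreeF-ssubF {z = z} {τ} {σ} h (`∃ φ) p = let x , q , r = FreeF-ssubF h↑ φ p in x , q , FreeT-ren z suc (τ x) r
  where
  h↑ : ∀ i → ¬ FreeT z (liftσ σ i)
  h↑ (suc i) r = h i (FreeT-ren z suc (σ i) r)

notFree-wk0 : {z : ℕ} (u : Term 0) → ¬ FreeT z u → ¬ FreeT z (wk0 {n} u)
notFree-wk0 {z = z} u h = h ∘ FreeT-ren z (λ ()) u

notFree-fsubF : (x : ℕ) (u : Term 0) (φ : Formula n) → ¬ FreeT x u → ¬ FreeF x (fsubF x u φ)
notFree-fsubF x u φ x∉u p
  with FreeF-ssubF {σ = bv} (λ _ q → q) φ (subst (FreeF x) (fsubF≡ssubF x u φ) p)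
... | y , _ , q with x ≟ y
...   | yes _ = notFree-wk0 u x∉u q
...   | no x≢y = x≢y q

wk0-id : (u : Term 0) → wk0 u ≡ u
wk0-id u = trans (renT≡ssubT (λ ()) u) (trans (ssubT-cong u (λ _ _ → refl) (λ ())) (ssubT-id u))

FreeF-fsubF : (x : ℕ) (u : Term 0) (φ : Formula n) {z : ℕ} → FreeF z (fsubF x u φ) → FreeF z φ ⊎ FreeT z u
FreeF-fsubF x u φ {z} p
  with FreeF-ssubF {σ = bv} (λ _ q → q) φ (subst (FreeF z) (fsubF≡ssubF x u φ) p)
... | y , y∈φ , q with x ≟ y
...   | yes _ = inj₂ (FreeT-ren z (λ ()) u q)
...   | no _ rewrite q = inj₁ y∈φ

fsubF-fsubF : (y : ℕ) (t u : Term 0) (φ : Formula 0) → fsubF y u (fsubF y t φ) ≡ fsubF y (fsubT y u t) φ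
fsubF-fsubF y t u φ =
  trans (fsubF≡ssubF y u (fsubF y t φ))
  (trans (cong (ssubF (fsub1 y u) bv) (fsubF≡ssubF y t φ))
  (trans (ssubF-fuse φ value (λ ())) (sym (fsubF≡ssubF y (fsubT y u t) φ))))
  where
  value : ∀ x → ssubT (fsub1 y u) bv (fsub1 y t x) ≡ fsub1 y (fsubT y u t) x
  value x with y ≟ x
  ... | yes _ = trans (cong (ssubT (fsub1 y u) bv) (wk0-id t))
                      (trans (sym (fsubT≡ssubT y u t)) (sym (wk0-id (fsubT y u t))))
  ... | no y≢x = fsub1-≢ y u x y≢x

fsubT-notFree : (x : ℕ) (u : Term 0) (t : Term n) → ¬ FreeT x t → fsubT x u t ≡ t
fsubT-notFree x u t x∉t = trans (fsubT≡ssubT x u t)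
  (trans (ssubT-cong t (λ y y∈t → fsub1-≢ x u y λ { refl → x∉t y∈t }) (λ _ → refl)) (ssubT-id t))

fsubT-hit : (x : ℕ) (u : Term 0) → fsubT {n} x u (fv x) ≡ wk0 u
fsubT-hit x u with x ≟ x
... | yes _ = refl
... | no x≢x = ⊥-elim (x≢x refl)

fsubT-hit₀ : (x : ℕ) (u : Term 0) → fsubT x u (fv x) ≡ u
fsubT-hit₀ x u = trans (fsubT-hit x u) (wk0-id u)

absV : ℕ → ℕ → Term (suc n)
absV y x with y ≟ x
... | yes _ = bv zero
... | no _ = fv x

abs : ℕ → Formula n → Formula (suc n)
abs y = ssubF (absV y) (bv ∘ suc)

FreeF-abs : {y z : ℕ} (φ : Formula n) → FreeF z (abs y φ) → FreeF z φ × z ≢ y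
FreeF-abs {y = y} {z} φ p with FreeF-ssubF {σ = bv ∘ suc} (λ _ q → q) φ p
... | x , q , r with y ≟ x
...   | no y≢x rewrite r = q , y≢x ∘ sym

notFree-abs : (y : ℕ) (φ : Formula n) → ¬ FreeF y (abs y φ)
notFree-abs y φ p = let _ , y≢y = FreeF-abs φ p in y≢y refl

abs-inst : (y : ℕ) (φ : Formula 0) (u : Term 0) → abs y φ ⟨ u ⟩ ≡ fsubF y u φ
abs-inst y φ u = trans (substF≡ssubF (λ _ → u) (abs y φ))
  (trans (ssubF-fuse φ value (λ ())) (sym (fsubF≡ssubF y u φ)))
  where
  value : ∀ x → ssubT fv (λ _ → u) (absV y x) ≡ fsub1 y u x
  value x with y ≟ x
  ... | yes _ = sym (wk0-id u)
  ... | no _ = refl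

abs-step-inst : (a b : ℕ) (φ : Formula 0) → stepF (abs a φ) ⟨ fv b ⟩ ≡ fsubF a (`S (fv b)) φ
abs-step-inst a b φ =
  trans (substF≡ssubF (λ _ → fv b) (stepF (abs a φ)))
  (trans (cong (ssubF fv (λ _ → fv b)) (substF≡ssubF (λ _ → `S (bv zero)) (abs a φ)))
  (trans (ssubF-fuse (abs a φ) (λ _ → refl) (λ _ → refl))
  (trans (ssubF-fuse φ value (λ ())) (sym (fsubF≡ssubF a (`S (fv b)) φ)))))
  where
  value : ∀ x → ssubT fv (λ _ → `S (fv b)) (absV a x) ≡ fsub1 a (`S (fv b)) x
  value x with a ≟ x
  ... | yes _ = refl
  ... | no _ = refl

_▸_ : Term 0 → (Fin n → Term 0) → Fin (suc n) → Term 0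
(t ▸ σ) zero = t
(t ▸ σ) (suc i) = σ i

-- Opening a quantifier extends the surrounding substitution by the witness, so that prefixes can be
-- treated one quantifier at a time.
subst-inst : (σ : Fin n → Term 0) (φ : Formula (suc n)) (t : Term 0) →
             substF (liftσ σ) φ ⟨ t ⟩ ≡ substF (t ▸ σ) φ
subst-inst σ φ t =
  trans (substF≡ssubF (λ _ → t) (substF (liftσ σ) φ))
  (trans (cong (ssubF fv (λ _ → t)) (substF≡ssubF (liftσ σ) φ))
  (trans (ssubF-fuse φ (λ _ → refl) value) (sym (substF≡ssubF (t ▸ σ) φ))))
  where
  value : ∀ i → ssubT fv (λ _ → t) (liftσ σ i) ≡ (t ▸ σ) i
  value zero = refl
  value (suc i) = trans (ssubT-ren fv (λ _ → t) suc (σ i))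
                        (trans (ssubT-cong (σ i) (λ _ _ → refl) (λ ())) (ssubT-id (σ i)))

wkF : Formula n → Formula (suc n)
wkF = ssubF fv (bv ∘ suc)

wkF-inst : (σ : Fin n → Term 0) (φ : Formula n) (t : Term 0) → substF (t ▸ σ) (wkF φ) ≡ substF σ φ
wkF-inst σ φ t = trans (substF≡ssubF (t ▸ σ) (wkF φ))
  (trans (ssubF-fuse φ (λ _ → refl) (λ _ → refl)) (sym (substF≡ssubF σ φ)))

-- The hierarchy under substitution and change of level

Delta0-ssubF : {τ : ℕ → Term n} {σ : Fin m → Term n} {φ : Formula m} → Delta0 φ → Delta0 (ssubF τ σ φ)
Delta0-ssubF (d-eq s t) = d-eq _ _
Delta0-ssubF d-bot = d-bot
Delta0-ssubF (d-and p q) = d-and (Delta0-ssubF p) (Delta0-ssubF q)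
Delta0-ssubF (d-or p q) = d-or (Delta0-ssubF p) (Delta0-ssubF q)
Delta0-ssubF (d-imp p q) = d-imp (Delta0-ssubF p) (Delta0-ssubF q)
-- The bound stands under two binders, the bounded quantifier and the one in `leF`. The rewrites
-- move both weakenings outside the substitution, so that the image is again a bounded quantifier.
Delta0-ssubF {τ = τ} {σ} (d-ball t {φ} p)
  rewrite ssubT-lift-wk (wkT ∘ τ) (liftσ σ) (wkT t) | ssubT-lift-wk τ σ t = d-ball (ssubT τ σ t) (Delta0-ssubF p)
Delta0-ssubF {τ = τ} {σ} (d-bex t {φ} p)
  rewrite ssubT-lift-wk (wkT ∘ τ) (liftσ σ) (wkT t) | ssubT-lift-wk τ σ t = d-bex (ssubT τ σ t) (Delta0-ssubF p)

Pi-ssubF : {k : ℕ} {τ : ℕ → Term n} {σ : Fin m → Term n} {φ : Formula m} → Pi k φ → Pi k (ssubF τ σ φ)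
Sigma-ssubF : {k : ℕ} {τ : ℕ → Term n} {σ : Fin m → Term n} {φ : Formula m} → Sigma k φ → Sigma k (ssubF τ σ φ)
Pi-ssubF (pi-d0 d) = pi-d0 (Delta0-ssubF d)
Pi-ssubF (pi-sig s) = pi-sig (Sigma-ssubF s)
Pi-ssubF (pi-all p) = pi-all (Pi-ssubF p)
Sigma-ssubF (sig-d0 d) = sig-d0 (Delta0-ssubF d)
Sigma-ssubF (sig-pi p) = sig-pi (Pi-ssubF p)
Sigma-ssubF (sig-ex s) = sig-ex (Sigma-ssubF s)

-- The quantifier prefix stays; only the matrix at its end passes through one more change of class.
Pi-suc : {k : ℕ} {φ : Formula n} → Pi k φ → Pi (suc k) φ
Sigma-suc : {k : ℕ} {φ : Formula n} → Sigma k φ → Sigma (suc k) φ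
Pi-suc (pi-d0 d) = pi-sig (sig-d0 d)
Pi-suc (pi-sig s) = pi-sig (Sigma-suc s)
Pi-suc (pi-all p) = pi-all (Pi-suc p)
Sigma-suc (sig-d0 d) = sig-pi (pi-d0 d)
Sigma-suc (sig-pi p) = sig-pi (Pi-suc p)
Sigma-suc (sig-ex s) = sig-ex (Sigma-suc s)

Delta0⇒Pi : (k : ℕ) {φ : Formula n} → Delta0 φ → Pi k φ
Delta0⇒Pi zero d = pi-d0 d
Delta0⇒Pi (suc k) d = Pi-suc (Delta0⇒Pi k d)

varsT : Term n → List ℕ
varsT (bv i) = []
varsT (fv x) = x ∷ []
varsT `0 = []
varsT (`S t) = varsT t
varsT (s `+ t) = varsT s ++ varsT t
varsT (s `· t) = varsT s ++ varsT t

vars : Formula n → List ℕ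
vars (s ≐ t) = varsT s ++ varsT t
vars `⊥ = []
vars (φ `∧ ψ) = vars φ ++ vars ψ
vars (φ `∨ ψ) = vars φ ++ vars ψ
vars (φ `→ ψ) = vars φ ++ vars ψ
vars (`∀ φ) = vars φ
vars (`∃ φ) = vars φ

FreeT⇒∈ : {x : ℕ} (t : Term n) → FreeT x t → x ∈ varsT t
FreeT⇒∈ (fv x) p = here p
FreeT⇒∈ (`S t) p = FreeT⇒∈ t p
FreeT⇒∈ (s `+ t) = [ ∈-++⁺ˡ ∘ FreeT⇒∈ s , ∈-++⁺ʳ (varsT s) ∘ FreeT⇒∈ t ]′
FreeT⇒∈ (s `· t) = [ ∈-++⁺ˡ ∘ FreeT⇒∈ s , ∈-++⁺ʳ (varsT s) ∘ FreeT⇒∈ t ]′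

FreeF⇒∈ : {x : ℕ} (φ : Formula n) → FreeF x φ → x ∈ vars φ
FreeF⇒∈ (s ≐ t) = [ ∈-++⁺ˡ ∘ FreeT⇒∈ s , ∈-++⁺ʳ (varsT s) ∘ FreeT⇒∈ t ]′
FreeF⇒∈ (φ `∧ ψ) = [ ∈-++⁺ˡ ∘ FreeF⇒∈ φ , ∈-++⁺ʳ (vars φ) ∘ FreeF⇒∈ ψ ]′
FreeF⇒∈ (φ `∨ ψ) = [ ∈-++⁺ˡ ∘ FreeF⇒∈ φ , ∈-++⁺ʳ (vars φ) ∘ FreeF⇒∈ ψ ]′
FreeF⇒∈ (φ `→ ψ) = [ ∈-++⁺ˡ ∘ FreeF⇒∈ φ , ∈-++⁺ʳ (vars φ) ∘ FreeF⇒∈ ψ ]′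
FreeF⇒∈ (`∀ φ) = FreeF⇒∈ φ
FreeF⇒∈ (`∃ φ) = FreeF⇒∈ φ

-- Derivability in PA

∈⇒≤sum : {x : ℕ} {xs : List ℕ} → x ∈ xs → x ≤ sum xs
∈⇒≤sum {xs = y ∷ ys} (here refl) = m≤m+n y (sum ys)
∈⇒≤sum {xs = y ∷ ys} (there p) = ≤-trans (∈⇒≤sum p) (m≤n+m (sum ys) y)

fresh : (xs : List ℕ) → ∃ λ y → y ∉ xs
fresh xs = suc (sum xs) , λ p → <⇒≢ (s≤s (∈⇒≤sum p)) refl

Fresh : ℕ → List (Formula 0) → Set
Fresh y = All (λ φ → ¬ FreeF y φ)

notIn-vars : ∀ {y} (Γ : List (Formula 0)) → y ∉ concatMap vars Γ → Fresh y Γ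
notIn-vars [] h = []
notIn-vars (φ ∷ Γ) h = h ∘ ∈-++⁺ˡ ∘ FreeF⇒∈ φ ∷ notIn-vars Γ (h ∘ ∈-++⁺ʳ (vars φ))

freshFor : (Γ : List (Formula 0)) → ∃ λ y → Fresh y Γ
freshFor Γ = let y , h = fresh (concatMap vars Γ) in y , notIn-vars Γ h

map-fsubF-fresh : ∀ {y} u {Γ} → Fresh y Γ → map (fsubF y u) Γ ≡ Γ
map-fsubF-fresh u [] = refl
map-fsubF-fresh {y} u (h ∷ hs) = cong₂ _∷_ (fsubF-notFree y u _ h) (map-fsubF-fresh u hs)

private variable
  Γ Γ' Δ Δ' Θ Λ : List (Formula 0)
  φ ψ : Formula 0

≋-refl : ∀ S → S ≋ S
≋-refl S = (id , id) , (id , id)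

Pointwise-≋-refl : ∀ Ss → Pointwise _≋_ Ss Ss
Pointwise-≋-refl [] = []
Pointwise-≋-refl (S ∷ Ss) = ≋-refl S ∷ Pointwise-≋-refl Ss

-- Sequents are sets, so a principal formula may be kept in the premises. This absorbs contraction
-- and lets the rules below be stated by membership.
absorb : φ ∈ Γ → Γ ≈ₗ (φ ∷ Γ)
absorb m = there , λ { (here refl) → m ; (there p) → p }

∷²⊆ : φ ∈ Γ → ψ ∈ Γ → (φ ∷ ψ ∷ []) ⊆ Γ
∷²⊆ p q (here refl) = p
∷²⊆ p q (there (here refl)) = q

module Calculus (K : ℕ) where

  P : List (Formula 0) → List (Formula 0) → Set
  P Γ Δ = PAProof K (Γ , Δ)

  rule : ∀ {ps} → BaseRule (Γ' , Δ') ps → Γ ≈ₗ Γ' → Δ ≈ₗ Δ' → All (PAProof K) ps → P Γ Δ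
  rule r e e' prems = by (inst _ _ (base r) (e , e') (Pointwise-≋-refl _)) prems

  weaken : Γ ⊆ Γ' → Δ ⊆ Δ' → P Γ Δ → P Γ' Δ'
  weaken {Γ} {Γ'} {Δ} {Δ'} f g p = rule (wk Γ' Δ') (into f) (into g) (p ∷ [])
    where
    into : ∀ {Ξ Ξ'} → Ξ ⊆ Ξ' → Ξ' ≈ₗ (Ξ ++ Ξ')
    into {Ξ} h = ∈-++⁺ʳ Ξ , [ h , id ]′ ∘ ∈-++⁻ Ξ

  wkR : P Γ [ φ ] → φ ∈ Δ → P Γ Δ
  wkR p m = weaken id (λ { (here refl) → m }) p

  axP : φ ∈ Γ → φ ∈ Δ → P Γ Δ
  axP m m' = rule (ax _) (absorb m) (absorb m') []

  botLP : `⊥ ∈ Γ → P Γ Δ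
  botLP m = rule botL (absorb m) (id , id) []

  eqRP : ∀ {t} → (t ≐ t) ∈ Δ → P Γ Δ
  eqRP m = rule (eqR _) (id , id) (absorb m) []

  eqLP : ∀ x φ s t → (s ≐ t) ∈ Γ → fsubF x s φ ∈ Γ → fsubF x t φ ∈ Δ → P Γ Δ
  eqLP x φ s t m m' m'' = rule (eqL x φ s t)
    (there ∘ there , λ { (here refl) → m ; (there (here refl)) → m' ; (there (there p)) → p }) (absorb m'') []

  andLP : (φ `∧ ψ) ∈ Γ → P (φ ∷ ψ ∷ Γ) Δ → P Γ Δ
  andLP m p = rule (andL _ _) (absorb m) (id , id) (p ∷ [])

  andRP : (φ `∧ ψ) ∈ Δ → P Γ (φ ∷ Δ) → P Γ (ψ ∷ Δ) → P Γ Δ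
  andRP m p q = rule (andR _ _) (id , id) (absorb m) (p ∷ q ∷ [])

  orLP : (φ `∨ ψ) ∈ Γ → P (φ ∷ Γ) Δ → P (ψ ∷ Γ) Δ → P Γ Δ
  orLP m p q = rule (orL _ _) (absorb m) (id , id) (p ∷ q ∷ [])

  orRP : (φ `∨ ψ) ∈ Δ → P Γ (φ ∷ ψ ∷ Δ) → P Γ Δ
  orRP m p = rule (orR _ _) (id , id) (absorb m) (p ∷ [])

  impLP : (φ `→ ψ) ∈ Γ → P Γ (φ ∷ Δ) → P (ψ ∷ Γ) Δ → P Γ Δ
  impLP m p q = rule (impL _ _) (absorb m) (id , id) (p ∷ q ∷ [])

  impRP : (φ `→ ψ) ∈ Δ → P (φ ∷ Γ) (ψ ∷ Δ) → P Γ Δ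
  impRP m p = rule (impR _ _) (id , id) (absorb m) (p ∷ [])

  cutP : ∀ φ → P Γ (φ ∷ Δ) → P (φ ∷ Γ) Δ → P Γ Δ
  cutP φ p q = rule (cut φ) (id , id) (id , id) (p ∷ q ∷ [])

  cut₁ : P Θ [ φ ] → P (φ ∷ Θ) Δ → P Θ Δ
  cut₁ p q = cutP _ (wkR p (here refl)) q

  allLP : ∀ φ t → `∀ φ ∈ Γ → P (φ ⟨ t ⟩ ∷ Γ) Δ → P Γ Δ
  allLP φ t m p = rule (allL φ t) (absorb m) (id , id) (p ∷ [])

  exRP : ∀ φ t → `∃ φ ∈ Δ → P Γ (φ ⟨ t ⟩ ∷ Δ) → P Γ Δ
  exRP φ t m p = rule (exR φ t) (id , id) (absorb m) (p ∷ [])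

  notFreeSeq : ∀ {y} → Fresh y Γ → Fresh y Δ → ¬ FreeSeq y (Γ , Δ)
  notFreeSeq p q = [ All¬⇒¬Any p , All¬⇒¬Any q ]′

  allRP : ∀ {φ} y → Fresh y Γ → Fresh y Δ → `∀ φ ∈ Δ → P Γ (φ ⟨ fv y ⟩ ∷ Δ) → P Γ Δ
  allRP y f g m p = rule (allR _ y (notFreeSeq f (All.lookup g m ∷ g))) (id , id) (absorb m) (p ∷ [])

  exLP : ∀ {φ} y → Fresh y Γ → Fresh y Δ → `∃ φ ∈ Γ → P (φ ⟨ fv y ⟩ ∷ Γ) Δ → P Γ Δ
  exLP y f g m p = rule (exL _ y (notFreeSeq (All.lookup f m ∷ f) g)) (absorb m) (id , id) (p ∷ [])

  -- The eigenvariable is chosen here, away from the whole sequent; asking for the premise at every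
  -- name spares later derivations the freshness conditions.
  allR∀ : ∀ {φ} → `∀ φ ∈ Δ → (∀ y → P Γ (φ ⟨ fv y ⟩ ∷ Δ)) → P Γ Δ
  allR∀ {Δ} {Γ} m p = let y , h = freshFor (Γ ++ Δ) in
    allRP y (All.++⁻ˡ Γ h) (All.++⁻ʳ Γ h) m (p y)

  exL∀ : ∀ {φ} → `∃ φ ∈ Γ → (∀ y → P (φ ⟨ fv y ⟩ ∷ Γ) Δ) → P Γ Δ
  exL∀ {Γ} {Δ = Δ} m p = let y , h = freshFor (Γ ++ Δ) in
    exLP y (All.++⁻ˡ Γ h) (All.++⁻ʳ Γ h) m (p y)

  multicut : (∀ {γ} → γ ∈ Γ → P Θ (γ ∷ Λ)) → (∀ {δ} → δ ∈ Δ → P (δ ∷ Θ) Λ) → P Γ Δ → P Θ Λ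
  multicut {Γ} {Θ} {Λ} {Δ} f g p = cutΔ Δ g (cutΓ Γ f (weaken ∈-++⁺ˡ ∈-++⁺ˡ p))
    where
    cutΓ : ∀ Γ → (∀ {γ} → γ ∈ Γ → P Θ (γ ∷ Λ)) → P (Γ ++ Θ) (Δ ++ Λ) → P Θ (Δ ++ Λ)
    cutΓ [] f p = p
    cutΓ (γ ∷ Γ) f p = cutΓ Γ (f ∘ there)
      (cutP γ (weaken (∈-++⁺ʳ Γ) (∷⁺ʳ γ (xs⊆ys++xs Λ Δ)) (f (here refl))) p)

    cutΔ : ∀ Δ → (∀ {δ} → δ ∈ Δ → P (δ ∷ Θ) Λ) → P Θ (Δ ++ Λ) → P Θ Λ
    cutΔ [] g p = p
    cutΔ (δ ∷ Δ) g p = cutΔ Δ (g ∘ there) (cutP δ p (weaken id (∈-++⁺ʳ Δ) (g (here refl))))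

  disjF : List (Formula 0) → Formula 0
  disjF [] = `⊥
  disjF (δ ∷ Δ) = δ `∨ disjF Δ

  -- With iterated implications no conjunction has to be taken apart, and prenexing needs only
  -- negation and disjunction.
  impF : List (Formula 0) → List (Formula 0) → Formula 0
  impF [] Δ = disjF Δ
  impF (γ ∷ Γ) Δ = γ `→ impF Γ Δ

  disjF-intro : P Γ Δ → P Γ [ disjF Δ ]
  disjF-intro = multicut (λ m → axP m (here refl)) inj
    where
    inj : ∀ {δ Δ} → δ ∈ Δ → P (δ ∷ Γ) [ disjF Δ ]
    inj (here refl) = orRP (here refl) (axP (here refl) (here refl))
    inj (there m) = orRP (here refl) (wkR (inj m) (there (here refl)))

  disjF-elim : ∀ Δ → P [ disjF Δ ] Δ
  disjF-elim [] = botLP (here refl)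
  disjF-elim (δ ∷ Δ) = orLP (here refl) (axP (here refl) (here refl))
    (weaken (λ { (here refl) → here refl }) there (disjF-elim Δ))

  impF-intro : ∀ Γ → P (Γ ++ Θ) Δ → P Θ [ impF Γ Δ ]
  impF-intro [] p = disjF-intro p
  impF-intro {Θ} (γ ∷ Γ) p = impRP (here refl) (wkR (impF-intro Γ (weaken swap id p)) (here refl))
    where
    swap : (γ ∷ Γ ++ Θ) ⊆ (Γ ++ γ ∷ Θ)
    swap (here e) = ∈-++⁺ʳ Γ (here e)
    swap (there m) = ++⁺ʳ Γ there m

  impF-elim : ∀ Γ Δ → P (impF Γ Δ ∷ Γ) Δ
  impF-elim [] Δ = disjF-elim Δ
  impF-elim (γ ∷ Γ) Δ = impLP (here refl) (axP (there (here refl)) (here refl))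
    (weaken (∷⁺ʳ _ (there ∘ there)) id (impF-elim Γ Δ))

  disjF-fsub : ∀ y u Δ → fsubF y u (disjF Δ) ≡ disjF (map (fsubF y u) Δ)
  disjF-fsub y u [] = refl
  disjF-fsub y u (δ ∷ Δ) = cong (fsubF y u δ `∨_) (disjF-fsub y u Δ)

  impF-fsub : ∀ y u Γ Δ → fsubF y u (impF Γ Δ) ≡ impF (map (fsubF y u) Γ) (map (fsubF y u) Δ)
  impF-fsub y u [] Δ = disjF-fsub y u Δ
  impF-fsub y u (γ ∷ Γ) Δ = cong (fsubF y u γ `→_) (impF-fsub y u Γ Δ)

  gen : ∀ y → Fresh y Γ → P Γ [ φ ] → P Γ [ `∀ (abs y φ) ]
  gen {φ = φ} y f p = allRP y f (notFree-abs y φ ∷ []) (here refl)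
    (wkR (subst (λ χ → P _ [ χ ]) (sym (trans (abs-inst y φ (fv y)) (fsubF-self y φ))) p) (here refl))

  spec : ∀ y φ u → P [ `∀ (abs y φ) ] [ fsubF y u φ ]
  spec y φ u = allLP (abs y φ) u (here refl) (axP (here refl) (here (abs-inst y φ u)))

  -- Substitution is derived by generalising the formula of the sequent.
  substP : ∀ y u → P Γ Δ → P (map (fsubF y u) Γ) (map (fsubF y u) Δ)
  substP {Γ} {Δ} y u p = cut₁
    (weaken (λ ()) id (cut₁ (gen y [] (impF-intro Γ (weaken ∈-++⁺ˡ id p))) (spec y (impF Γ Δ) u)))
    (subst (λ χ → P (χ ∷ map (fsubF y u) Γ) (map (fsubF y u) Δ)) (sym (impF-fsub y u Γ Δ))
      (impF-elim (map (fsubF y u) Γ) (map (fsubF y u) Δ)))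

  -- Equality, induction and the arithmetic behind case distinctions

  leibniz : ∀ x φ s t {A B} → fsubF x s φ ≡ A → fsubF x t φ ≡ B → P Γ [ s ≐ t ] → P Γ [ A ] → P Γ [ B ]
  leibniz x φ s t refl refl p q = cut₁ p (cut₁ (weaken there id q)
    (eqLP x φ s t (there (here refl)) (here refl) (here refl)))

  reflE : ∀ t → P Γ [ t ≐ t ]
  reflE t = eqRP (here refl)

  symE : ∀ s t → P Γ [ s ≐ t ] → P Γ [ t ≐ s ]
  symE s t p = let x , h = fresh (varsT s) in
    leibniz x (fv x ≐ s) s t
      (cong₂ _≐_ (fsubT-hit₀ x s) (fsubT-notFree x s s (h ∘ FreeT⇒∈ s)))
      (cong₂ _≐_ (fsubT-hit₀ x t) (fsubT-notFree x t s (h ∘ FreeT⇒∈ s)))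
      p (reflE s)

  transE : ∀ s t u → P Γ [ s ≐ t ] → P Γ [ t ≐ u ] → P Γ [ s ≐ u ]
  transE s t u p q = let x , h = fresh (varsT s) in
    leibniz x (s ≐ fv x) t u
      (cong₂ _≐_ (fsubT-notFree x t s (h ∘ FreeT⇒∈ s)) (fsubT-hit₀ x t))
      (cong₂ _≐_ (fsubT-notFree x u s (h ∘ FreeT⇒∈ s)) (fsubT-hit₀ x u))
      q p

  congS : ∀ s t → P Γ [ s ≐ t ] → P Γ [ `S s ≐ `S t ]
  congS s t p = let x , h = fresh (varsT s) in
    leibniz x (`S s ≐ `S (fv x)) s t
      (cong₂ (λ a b → `S a ≐ `S b) (fsubT-notFree x s s (h ∘ FreeT⇒∈ s)) (fsubT-hit₀ x s))
      (cong₂ (λ a b → `S a ≐ `S b) (fsubT-notFree x t s (h ∘ FreeT⇒∈ s)) (fsubT-hit₀ x t))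
      p (reflE (`S s))

  plus0 : ∀ s → P Γ [ (s `+ `0) ≐ s ]
  plus0 s = weaken (λ ()) id (rule (ar-p0 s) (id , id) (id , id) [])

  plusS : ∀ s t → P Γ [ (s `+ `S t) ≐ `S (s `+ t) ]
  plusS s t = weaken (λ ()) id (rule (ar-pS s t) (id , id) (id , id) [])

  S-inj : ∀ s t → P Γ [ `S s ≐ `S t ] → P Γ [ s ≐ t ]
  S-inj s t p = cut₁ p (weaken (λ { (here refl) → here refl }) id (rule (ar-ss s t) (id , id) (id , id) []))

  S≢0 : ∀ t → P Γ [ `S t ≐ `0 ] → P Γ Δ
  S≢0 t p = cut₁ (symE _ _ p)
    (cut₁ (weaken (λ ()) id (rule (ar-zs t) (id , id) (id , id) []))
      (impLP (here refl) (axP (there (here refl)) (here refl)) (botLP (here refl))))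

  -- The axiom expects a formula with a hole, which abstracting the name `a` provides. The
  -- eigenvariable of the step is a separate name `b`, so that `a` may be free in `Γ`.
  induction : ∀ a b I s → Pi K I → Fresh b Γ → ¬ FreeF b I →
              P Γ [ fsubF a `0 I ] → P (fsubF a (fv b) I ∷ Γ) [ fsubF a (`S (fv b)) I ] →
              P Γ [ fsubF a s I ]
  induction {Γ} a b I s πI b∉Γ b∉I p q =
    cut₁ (subst (λ χ → P Γ [ χ ]) (sym (abs-inst a I `0)) p)
    (cut₁ (weaken there id step)
      (subst (λ χ → P (`∀ (abs a I `→ stepF (abs a I)) ∷ abs a I ⟨ `0 ⟩ ∷ Γ) [ χ ]) (abs-inst a I s)
        (weaken (∷²⊆ (there (here refl)) (here refl)) id
          (by (inst _ _ (ind (abs a I) s (Pi-ssubF πI)) (≋-refl _) []) []))))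
    where
    χ₀ = abs a I

    b∉χ₀ : ¬ FreeF b χ₀
    b∉χ₀ = b∉I ∘ proj₁ ∘ FreeF-abs I

    b∉step : ¬ FreeF b (χ₀ `→ stepF χ₀)
    b∉step (inj₁ r) = b∉χ₀ r
    b∉step (inj₂ r)
      with FreeF-ssubF (λ _ ()) χ₀ (subst (FreeF b) (substF≡ssubF _ χ₀) r)
    ... | x , x∈χ₀ , refl = b∉χ₀ x∈χ₀

    step : P Γ [ `∀ (χ₀ `→ stepF χ₀) ]
    step = allRP b b∉Γ (b∉step ∷ []) (here refl) (impRP (here refl)
      (wkR (subst₂ (λ χ χ' → P (χ ∷ Γ) [ χ' ]) (sym (abs-inst a I (fv b))) (sym (abs-step-inst a b I)) q)
           (here refl)))

  -- The axioms recurse on the right summand, so taking a successor off the left one needs an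
  -- induction, here on an equation and hence available at every level. It serves to trade a
  -- successor on `x` for one on the witness `z` of a bound.
  S-plus : ∀ z s → P Γ [ (`S (fv z) `+ s) ≐ `S (fv z `+ s) ]
  S-plus z s = weaken (λ ()) id (subst (λ χ → P [] [ χ ]) (value s)
    (induction a b (I (fv a)) s (Delta0⇒Pi K (d-eq _ _)) []
      (λ { (inj₁ (inj₁ e)) → b∉ (here e) ; (inj₁ (inj₂ e)) → b∉ (there (here e))
         ; (inj₂ (inj₁ e)) → b∉ (here e) ; (inj₂ (inj₂ e)) → b∉ (there (here e)) })
      (subst (λ χ → P [] [ χ ]) (sym (value `0))
        (transE _ _ _ (plus0 _) (congS _ _ (symE _ _ (plus0 (fv z))))))
      (subst₂ (λ χ χ' → P [ χ ] [ χ' ]) (sym (value (fv b))) (sym (value (`S (fv b))))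
        (transE _ _ _ (plusS _ _) (congS _ _
          (transE _ _ _ (axP (here refl) (here refl)) (symE _ _ (plusS (fv z) (fv b)))))))))
    where
    I : Term 0 → Formula 0
    I t = (`S (fv z) `+ t) ≐ `S (fv z `+ t)
    a = proj₁ (fresh (z ∷ []))
    a∉ = proj₂ (fresh (z ∷ []))
    b = proj₁ (fresh (z ∷ a ∷ []))
    b∉ = proj₂ (fresh (z ∷ a ∷ []))

    value : ∀ t → fsubF a t (I (fv a)) ≡ I t
    value t = cong₂ (λ z' t' → (`S z' `+ t') ≐ `S (z' `+ t'))
      (fsub1-≢ a t z (λ e → a∉ (here e))) (fsubT-hit₀ a t)

  -- The bound on the predecessor makes the formula Delta0, hence available for induction.
  caseF : Term 0 → Formula 0
  caseF t = (t ≐ `0) `∨ `∃ (leF (bv zero) (wk0 t) `∧ (wk0 t ≐ `S (bv zero)))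

  caseF-valid : ∀ y → P Γ [ caseF (fv y) ]
  caseF-valid y = weaken (λ ()) id
    (induction 0 1 (caseF (fv 0)) (fv y) (Delta0⇒Pi K (d-or (d-eq _ _) (d-bex (fv 0) (d-eq _ _)))) []
      (λ { (inj₁ (inj₁ ())) ; (inj₁ (inj₂ ())) ; (inj₂ (inj₁ (inj₁ (inj₁ ())))) ; (inj₂ (inj₁ (inj₁ (inj₂ ()))))
         ; (inj₂ (inj₁ (inj₂ ()))) ; (inj₂ (inj₂ (inj₁ ()))) ; (inj₂ (inj₂ (inj₂ ()))) })
      (orRP (here refl) (eqRP (here refl)))
      (orRP (here refl) (exRP _ (fv 1) (there (here refl))
        (andRP (here refl)
          -- The difference 1 witnesses that the predecessor lies below its successor.
          (exRP _ (`S `0) (here refl) (wkR (transE _ _ _ (plusS _ _) (congS _ _ (plus0 _))) (here refl)))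
          (eqRP (here refl))))))

  zero-or-suc : ∀ y → P (fv y ≐ `0 ∷ Θ) Λ → (∀ w → P (fv y ≐ `S (fv w) ∷ Θ) Λ) → P Θ Λ
  zero-or-suc y p q = cut₁ (caseF-valid y) (orLP (here refl)
    (weaken (∷⁺ʳ _ there) id p)
    (exL∀ (here refl) λ w → andLP (here refl)
      (weaken (λ { (here e) → there (here e) ; (there m) → there (there (there (there (there m)))) }) id (q w))))

  rewriteSeq : ∀ Γ Δ y t → P (map (fsubF y t) Γ ++ Θ) (map (fsubF y t) Δ) → P (fv y ≐ t ∷ Γ ++ Θ) Δ
  rewriteSeq {Θ} Γ Δ y t = multicut left right
    where
    left : ∀ {γ'} → γ' ∈ map (fsubF y t) Γ ++ Θ → P (fv y ≐ t ∷ Γ ++ Θ) (γ' ∷ Δ)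
    left m with ∈-++⁻ (map (fsubF y t) Γ) m
    ... | inj₂ m' = axP (there (∈-++⁺ʳ Γ m')) (here refl)
    ... | inj₁ m' with ∈-map⁻ (fsubF y t) m'
    ...   | γ , γ∈Γ , refl = wkR (leibniz y γ (fv y) t (fsubF-self y γ) refl
              (axP (here refl) (here refl)) (axP (there (∈-++⁺ˡ γ∈Γ)) (here refl))) (here refl)

    right : ∀ {δ'} → δ' ∈ map (fsubF y t) Δ → P (δ' ∷ fv y ≐ t ∷ Γ ++ Θ) Δ
    right m with ∈-map⁻ (fsubF y t) m
    ... | δ , δ∈Δ , refl = wkR (leibniz y δ t (fv y) refl (fsubF-self y δ)
            (symE _ _ (axP (there (here refl)) (here refl))) (axP (here refl) (here refl))) δ∈Δ

  -- The predecessor supplied by `zero-or-suc` is a new name `w`, so the successor premise is first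
  -- renamed from `y` to `w`. The renaming must leave `Θ` alone, whence the freshness condition.
  caseP : ∀ Γ Δ y → Fresh y Θ →
          P (map (fsubF y `0) Γ ++ Θ) (map (fsubF y `0) Δ) →
          P (map (fsubF y (`S (fv y))) Γ ++ Θ) (map (fsubF y (`S (fv y))) Δ) →
          P (Γ ++ Θ) Δ
  caseP {Θ} Γ Δ y y∉Θ p q = zero-or-suc y (rewriteSeq Γ Δ y `0 p) λ w →
    rewriteSeq Γ Δ y (`S (fv w)) (subst₂ P (left w) (rename w Δ) (substP y (fv w) q))
    where
    rename : ∀ w Ξ → map (fsubF y (fv w)) (map (fsubF y (`S (fv y))) Ξ) ≡ map (fsubF y (`S (fv w))) Ξ
    rename w [] = refl
    rename w (ξ ∷ Ξ) = cong₂ _∷_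
      (trans (fsubF-fsubF y (`S (fv y)) (fv w) ξ)
             (cong (λ t → fsubF y (`S t) ξ) (fsubT-hit₀ y (fv w))))
      (rename w Ξ)

    left : ∀ w → map (fsubF y (fv w)) (map (fsubF y (`S (fv y))) Γ ++ Θ) ≡ map (fsubF y (`S (fv w))) Γ ++ Θ
    left w = trans (map-++ (fsubF y (fv w)) (map (fsubF y (`S (fv y))) Γ) Θ)
                   (cong₂ _++_ (rename w Γ) (map-fsubF-fresh (fv w) y∉Θ))

-- Prenex forms

module Prenex (K : ℕ) where
  open Calculus K

  private variable
    k : ℕ

  -- Sequents admit only formulas without loose indices, so equivalence below a quantifier prefix is
  -- expressed through all instances of the indices.
  _⟺_ : Formula m → Formula m → Set
  χ ⟺ φ = ∀ σ → P [ substF σ χ ] [ substF σ φ ] × P [ substF σ φ ] [ substF σ χ ]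

  ⟺-refl : {φ : Formula m} → φ ⟺ φ
  ⟺-refl σ = axP (here refl) (here refl) , axP (here refl) (here refl)

  closed : {χ φ : Formula 0} → χ ⟺ φ → P [ χ ] [ φ ] × P [ φ ] [ χ ]
  closed {χ} {φ} e = subst₂ (λ a b → P [ a ] [ b ] × P [ b ] [ a ]) (substF-id χ) (substF-id φ) (e (λ ()))
    where
    substF-id : ∀ φ → substF (λ ()) φ ≡ φ
    substF-id φ = trans (substF≡ssubF (λ ()) φ) (trans (ssubF-cong φ (λ _ _ → refl) (λ ())) (ssubF-id φ))

  at : {χ φ : Formula (suc m)} → χ ⟺ φ → ∀ σ t →
       P [ substF (liftσ σ) χ ⟨ t ⟩ ] [ substF (liftσ σ) φ ⟨ t ⟩ ] ×
       P [ substF (liftσ σ) φ ⟨ t ⟩ ] [ substF (liftσ σ) χ ⟨ t ⟩ ]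
  at {χ = χ} {φ} e σ t = subst₂ (λ a b → P [ a ] [ b ] × P [ b ] [ a ])
    (sym (subst-inst σ χ t)) (sym (subst-inst σ φ t)) (e (t ▸ σ))

  chain : ∀ {Γ} {α β : Formula 0} → P Γ [ α ] → P [ α ] [ β ] → P Γ [ β ]
  chain p q = cut₁ p (weaken (λ { (here refl) → here refl }) id q)

  neg-∀ : {χ φ : Formula (suc m)} → χ ⟺ (φ `→ `⊥) → (`∃ χ) ⟺ (`∀ φ `→ `⊥)
  neg-∀ {χ = χ} {φ} e σ =
    impRP (here refl) (exL∀ (there (here refl)) λ y → allLP _ (fv y) (there (here refl))
      (cut₁ (chain (axP (there (here refl)) (here refl)) (proj₁ (at e σ (fv y))))
        (impLP (here refl) (axP (there (here refl)) (here refl)) (botLP (here refl))))) ,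
    impLP (here refl)
      (allR∀ (here refl) λ y → exRP _ (fv y) (there (there (here refl)))
        -- Excluded middle: the instance of `φ` stays on the right while the cut brings its negation
        -- to the left.
        (cutP (substF (liftσ σ) (φ `→ `⊥) ⟨ fv y ⟩)
          (impRP (here refl) (axP (here refl) (there (there (there (here refl))))))
          (wkR (chain (axP (here refl) (here refl)) (proj₂ (at e σ (fv y)))) (here refl))))
      (botLP (here refl))

  neg-∃ : {χ φ : Formula (suc m)} → χ ⟺ (φ `→ `⊥) → (`∀ χ) ⟺ (`∃ φ `→ `⊥)
  neg-∃ {χ = χ} {φ} e σ =
    impRP (here refl) (exL∀ (here refl) λ y → allLP _ (fv y) (there (there (here refl)))
      (cut₁ (chain (axP (here refl) (here refl)) (proj₁ (at e σ (fv y))))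
        (impLP (here refl) (axP (there (there (here refl))) (here refl)) (botLP (here refl))))) ,
    allR∀ (here refl) λ y →
      (cutP (substF (liftσ σ) (φ `→ `⊥) ⟨ fv y ⟩)
        (impRP (here refl) (impLP (there (here refl))
          (exRP _ (fv y) (here refl) (axP (here refl) (here refl))) (botLP (here refl))))
        (wkR (chain (axP (here refl) (here refl)) (proj₂ (at e σ (fv y)))) (here refl)))

  negPi : {φ : Formula m} → Pi k φ → ∃ λ χ → Sigma k χ × χ ⟺ (φ `→ `⊥)
  negSigma : {φ : Formula m} → Sigma k φ → ∃ λ χ → Pi k χ × χ ⟺ (φ `→ `⊥)
  negPi (pi-d0 d) = _ , sig-d0 (d-imp d d-bot) , ⟺-refl
  negPi (pi-sig s) = let χ , p , e = negSigma s in χ , sig-pi p , e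
  negPi (pi-all p) = let χ , s , e = negPi p in `∃ χ , sig-ex s , neg-∀ e
  negSigma (sig-d0 d) = _ , pi-d0 (d-imp d d-bot) , ⟺-refl
  negSigma (sig-pi p) = let χ , s , e = negPi p in χ , pi-sig s , e
  negSigma (sig-ex s) = let χ , p , e = negSigma s in `∀ χ , pi-all p , neg-∃ e

  ∨-swap : {χ φ ψ : Formula m} → χ ⟺ (φ `∨ ψ) → χ ⟺ (ψ `∨ φ)
  ∨-swap e σ = chain (proj₁ (e σ)) swap , chain swap (proj₂ (e σ))
    where
    swap : ∀ {α β} → P [ α `∨ β ] [ β `∨ α ]
    swap = orRP (here refl) (orLP (here refl)
      (axP (here refl) (there (here refl))) (axP (here refl) (here refl)))

  at-∨ : {χ φ : Formula (suc m)} {ψ : Formula m} → χ ⟺ (φ `∨ wkF ψ) → ∀ σ t →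
         P [ substF (liftσ σ) χ ⟨ t ⟩ ] [ (substF (liftσ σ) φ ⟨ t ⟩) `∨ substF σ ψ ] ×
         P [ (substF (liftσ σ) φ ⟨ t ⟩) `∨ substF σ ψ ] [ substF (liftσ σ) χ ⟨ t ⟩ ]
  at-∨ {χ = χ} {φ} {ψ} e σ t = subst
    (λ β → P [ substF (liftσ σ) χ ⟨ t ⟩ ] [ (substF (liftσ σ) φ ⟨ t ⟩) `∨ β ] ×
           P [ (substF (liftσ σ) φ ⟨ t ⟩) `∨ β ] [ substF (liftσ σ) χ ⟨ t ⟩ ])
    (trans (subst-inst σ (wkF ψ) t) (wkF-inst σ ψ t)) (at e σ t)

  pull-∀ : {χ φ : Formula (suc m)} {ψ : Formula m} → χ ⟺ (φ `∨ wkF ψ) → (`∀ χ) ⟺ (`∀ φ `∨ ψ)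
  pull-∀ e σ =
    orRP (here refl) (allR∀ (here refl) λ y → allLP _ (fv y) (here refl)
      (cut₁ (chain (axP (here refl) (here refl)) (proj₁ (at-∨ e σ (fv y))))
        (orLP (here refl) (axP (here refl) (here refl))
                          (axP (here refl) (there (there (here refl))))))) ,
    allR∀ (here refl) λ y → wkR
      (chain (orRP (here refl) (orLP (here refl)
               (allLP _ (fv y) (here refl) (axP (here refl) (here refl)))
               (axP (here refl) (there (here refl)))))
             (proj₂ (at-∨ e σ (fv y)))) (here refl)

  pull-∃ : {χ φ : Formula (suc m)} {ψ : Formula m} → χ ⟺ (φ `∨ wkF ψ) → (`∃ χ) ⟺ (`∃ φ `∨ ψ)
  pull-∃ e σ =
    exL∀ (here refl) (λ y → cut₁ (chain (axP (here refl) (here refl)) (proj₁ (at-∨ e σ (fv y))))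
      (orRP (here refl) (orLP (here refl)
        (exRP _ (fv y) (here refl) (axP (here refl) (here refl)))
        (axP (here refl) (there (here refl)))))) ,
    orLP (here refl)
      (exL∀ (here refl) λ y → exRP _ (fv y) (here refl) (wkR
        (chain (orRP (here refl) (axP (here refl) (here refl))) (proj₂ (at-∨ e σ (fv y)))) (here refl)))
      -- If `ψ` holds, any witness will do.
      (exRP _ `0 (here refl) (wkR
        (chain (orRP (here refl) (axP (here refl) (there (here refl)))) (proj₂ (at-∨ e σ `0))) (here refl)))

  -- The prefixes are merged block by block. The leading quantifiers of the left disjunct are pulled
  -- out, then those of the right one, until both lie in the dual class one level down; so the level
  -- does not grow.
  orPi : ∀ k {φ ψ : Formula m} → Pi k φ → Pi k ψ → ∃ λ χ → Pi k χ × χ ⟺ (φ `∨ ψ)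
  orSigmaPi : ∀ k {φ ψ : Formula m} → Sigma k φ → Pi (suc k) ψ → ∃ λ χ → Pi (suc k) χ × χ ⟺ (φ `∨ ψ)
  orSigma : ∀ k {φ ψ : Formula m} → Sigma k φ → Sigma k ψ → ∃ λ χ → Sigma k χ × χ ⟺ (φ `∨ ψ)
  orPiSigma : ∀ k {φ ψ : Formula m} → Pi k φ → Sigma (suc k) ψ → ∃ λ χ → Sigma (suc k) χ × χ ⟺ (φ `∨ ψ)
  orPi zero (pi-d0 d) (pi-d0 d') = _ , pi-d0 (d-or d d') , ⟺-refl
  orPi (suc k) (pi-sig s) q = orSigmaPi k s q
  orPi (suc k) (pi-all p) q = let χ , r , e = orPi (suc k) p (Pi-ssubF q) in `∀ χ , pi-all r , pull-∀ e
  orSigmaPi k s (pi-sig s') = let χ , r , e = orSigma k s s' in χ , pi-sig r , e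
  orSigmaPi k s (pi-all q) = let χ , r , e = orSigmaPi k (Sigma-ssubF s) q in
    `∀ χ , pi-all r , ∨-swap (pull-∀ (∨-swap e))
  orSigma zero (sig-d0 d) (sig-d0 d') = _ , sig-d0 (d-or d d') , ⟺-refl
  orSigma (suc k) (sig-pi p) q = orPiSigma k p q
  orSigma (suc k) (sig-ex s) q = let χ , r , e = orSigma (suc k) s (Sigma-ssubF q) in `∃ χ , sig-ex r , pull-∃ e
  orPiSigma k p (sig-pi q) = let χ , r , e = orPi k p q in χ , sig-pi r , e
  orPiSigma k p (sig-ex s) = let χ , r , e = orPiSigma k (Pi-ssubF p) s in
    `∃ χ , sig-ex r , ∨-swap (pull-∃ (∨-swap e))

  -- De Morgan: a conjunction is the negation of a disjunction of negations, so no second merging of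
  -- prefixes is needed.
  andPi : {φ ψ : Formula 0} → Pi k φ → Pi k ψ →
          ∃ λ χ → Pi k χ × P [ χ ] [ φ ] × P [ χ ] [ ψ ] × P (φ ∷ ψ ∷ []) [ χ ]
  andPi {k} p q =
    let ν₁ , s₁ , e₁ = negPi p
        ν₂ , s₂ , e₂ = negPi q
        δ , s , e = orSigma k s₁ s₂
        χ , r , f = negSigma s
    in χ , r
       , cut₁ (proj₁ (closed f)) (impLP (here refl)
           (cutP ν₁ (cutP (_ `→ `⊥)
                      (impRP (here refl) (axP (here refl) (there (there (there (there (here refl)))))))
                      (wkR (chain (axP (here refl) (here refl)) (proj₂ (closed e₁))) (here refl)))
             (wkR (chain (orRP (here refl) (axP (here refl) (here refl))) (proj₂ (closed e))) (here refl)))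
           (botLP (here refl)))
       , cut₁ (proj₁ (closed f)) (impLP (here refl)
           (cutP ν₂ (cutP (_ `→ `⊥)
                      (impRP (here refl) (axP (here refl) (there (there (there (there (here refl)))))))
                      (wkR (chain (axP (here refl) (here refl)) (proj₂ (closed e₂))) (here refl)))
             (wkR (chain (orRP (here refl) (axP (here refl) (there (here refl)))) (proj₂ (closed e))) (here refl)))
           (botLP (here refl)))
       , chain (impRP (here refl) (cut₁ (chain (axP (here refl) (here refl)) (proj₁ (closed e)))
           (orLP (here refl)
             (cut₁ (chain (axP (here refl) (here refl)) (proj₁ (closed e₁)))
               (impLP (here refl) (axP (there (there (there (there (here refl))))) (here refl)) (botLP (here refl))))
             (cut₁ (chain (axP (here refl) (here refl)) (proj₁ (closed e₂)))
               (impLP (here refl) (axP (there (there (there (there (there (here refl)))))) (here refl)) (botLP (here refl)))))))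
         (proj₂ (closed f))

  disjF-Pi : ∀ Δ → All (Pi k) Δ → ∃ λ χ → Pi k χ × P [ χ ] [ disjF Δ ] × P [ disjF Δ ] [ χ ]
  disjF-Pi {k} [] [] = `⊥ , Delta0⇒Pi k d-bot , axP (here refl) (here refl) , axP (here refl) (here refl)
  disjF-Pi {k} (δ ∷ Δ) (p ∷ ps) =
    let χ , q , f , g = disjF-Pi Δ ps
        ρ , r , e = orPi k p q
    in ρ , r
       , chain (proj₁ (closed e)) (orRP (here refl) (orLP (here refl)
           (axP (here refl) (here refl))
           (wkR (chain (axP (here refl) (here refl)) f) (there (here refl)))))
       , chain (orRP (here refl) (orLP (here refl)
           (axP (here refl) (here refl))
           (wkR (chain (axP (here refl) (here refl)) g) (there (here refl))))) (proj₂ (closed e))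

  -- This is the origin of the level `n + 1`: an antecedent in Π_k enters negated, as a Σ_k formula,
  -- and its disjunction with the Π_k succedents is brought into Π_{k+1}.
  impF-Pi : ∀ Γ Δ → All (Pi k) Γ → All (Pi k) Δ →
            ∃ λ χ → Pi (suc k) χ × P [ χ ] [ impF Γ Δ ] × P [ impF Γ Δ ] [ χ ]
  impF-Pi [] Δ [] qs = disjF-Pi Δ (All.map Pi-suc qs)
  impF-Pi {k} (γ ∷ Γ) Δ (p ∷ ps) qs =
    let χ , q , f , g = impF-Pi Γ Δ ps qs
        ν , s , e = negPi p
        ρ , r , h = orPi (suc k) (pi-sig s) q
    in ρ , r
       , impRP (here refl) (cut₁ (chain (axP (there (here refl)) (here refl)) (proj₁ (closed h)))
           (orLP (here refl)
             (cut₁ (chain (axP (here refl) (here refl)) (proj₁ (closed e)))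
               (impLP (here refl) (axP (there (there (there (here refl)))) (here refl)) (botLP (here refl))))
             (wkR (chain (axP (here refl) (here refl)) f) (here refl))))
       , chain (orRP (here refl) (cutP (γ `→ `⊥)
           (impRP (here refl) (impLP (there (here refl))
             (axP (here refl) (here refl))
             (wkR (chain (axP (here refl) (here refl)) g) (there (there (there (here refl)))))))
           (wkR (chain (axP (here refl) (here refl)) (proj₂ (closed e))) (here refl))))
         (proj₂ (closed h))

  Sq : Sequent → Formula 0
  Sq (Γ , Δ) = impF Γ Δ

  -- The formula is returned together with its elimination and introduction, which are all that is
  -- used of it later; its prenex shape stays hidden.
  conj-Pi : ∀ Ss → All (AllPi k) Ss → ∃ λ χ → Pi (suc k) χ × (∀ {S} → S ∈ Ss → P [ χ ] [ Sq S ]) ×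
            (∀ {Θ} → (∀ {S} → S ∈ Ss → P Θ [ Sq S ]) → P Θ [ χ ])
  conj-Pi {k} [] [] = (`⊥ `→ `⊥) , Delta0⇒Pi (suc k) (d-imp d-bot d-bot) , (λ ()) ,
    λ _ → impRP (here refl) (botLP (here refl))
  conj-Pi ((Γ , Δ) ∷ Ss) ((p , q) ∷ ps) =
    let α , r , f , g = impF-Pi Γ Δ p q
        χ , s , elim , intro = conj-Pi Ss ps
        ρ , t , π₁ , π₂ , pair = andPi r s
    in ρ , t
       , (λ { (here refl) → chain π₁ f ; (there m) → chain π₂ (elim m) })
       , λ h → cut₁ (chain (h (here refl)) g) (cut₁ (weaken there id (intro (h ∘ there)))
                 (weaken (∷²⊆ (there (here refl)) (here refl)) id pair))

  close : List ℕ → Formula 0 → Formula 0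
  close [] φ = φ
  close (z ∷ zs) φ = `∀ (abs z (close zs φ))

  close-Pi : ∀ zs {φ} → Pi (suc k) φ → Pi (suc k) (close zs φ)
  close-Pi [] p = p
  close-Pi (z ∷ zs) p = pi-all (Pi-ssubF (close-Pi zs p))

  close-notFree : ∀ zs {φ z} → z ∈ zs → ¬ FreeF z (close zs φ)
  close-notFree (z ∷ zs) {φ} (here refl) = notFree-abs z (close zs φ)
  close-notFree (z ∷ zs) {φ} (there m) = close-notFree zs {φ} m ∘ proj₁ ∘ FreeF-abs (close zs φ)

  close-elim : ∀ zs φ → P [ close zs φ ] [ φ ]
  close-elim [] φ = axP (here refl) (here refl)
  close-elim (z ∷ zs) φ = chain
    (subst (λ χ → P [ `∀ (abs z (close zs φ)) ] [ χ ]) (fsubF-self z (close zs φ)) (spec z (close zs φ) (fv z)))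
    (close-elim zs φ)

  close-intro : ∀ zs {Θ φ} → (∀ {z} → z ∈ zs → Fresh z Θ) → P Θ [ φ ] → P Θ [ close zs φ ]
  close-intro [] h p = p
  close-intro (z ∷ zs) h p = gen z (h (here refl)) (close-intro zs (h ∘ there) p)

  -- ∀ zs. ⋀ S over S ∈ Ss, in prenex form.
  closure-Pi : ∀ (zs : List ℕ) Ss → All (AllPi k) Ss → ∃ λ I → Pi (suc k) I ×
    (∀ {z} → z ∈ zs → ¬ FreeF z I) ×
    (∀ {S} → S ∈ Ss → P (I ∷ proj₁ S) (proj₂ S)) ×
    (∀ {Θ} → (∀ {z} → z ∈ zs → Fresh z Θ) → (∀ {S} → S ∈ Ss → P (proj₁ S ++ Θ) (proj₂ S)) → P Θ [ I ])
  closure-Pi zs Ss ps =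
    let χ , p , elim , intro = conj-Pi Ss ps
    in close zs χ , close-Pi zs p , (λ {z} m → close-notFree zs {χ} m)
       , (λ {S} m → cut₁ (weaken (λ { (here refl) → here refl }) id (chain (close-elim zs χ) (elim m)))
                     (weaken (∷⁺ʳ _ there) id (impF-elim (proj₁ S) (proj₂ S))))
       , λ h k → close-intro zs h (intro λ {S} m → impF-intro (proj₁ S) (k m))

-- Strong connectivity and infinite walks

module Graph {V : Set} (_≟_ : DecidableEquality V) where
  open import Data.List.Membership.DecPropositional _≟_ using (_∈?_)

  _without_ : List V → V → List V
  U without v = filter (λ u → ¬? (u ≟ v)) U

  without-< : ∀ {v U} → v ∈ U → length (U without v) < length U
  without-< m = filter-notAll _ _ (lose m λ v≢v → v≢v refl)

  module _ {R : Rel V 0ℓ} (R? : Decidable R) (v : V) where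

    -- Worklist search: A is reached, B is still to be explored.
    search : ∀ N A B → length B ≤ N → All (Star R v) A →
             ∃ λ A' → All (Star R v) A' × (∀ {u} → u ∈ A → u ∈ A') ×
             (∀ {u q} → u ∈ A' → q ∈ B → R u q → q ∈ A')
    search N A B le reached with any? (λ q → any? (λ u → R? u q) A) B
    ... | no closed = A , reached , id , λ u∈A q∈B r → ⊥-elim (closed (lose q∈B (lose u∈A r)))
    ... | yes found with find found
    ...   | q , q∈B , found' with find found'
    ...     | u , u∈A , r with N
    ...       | zero = ⊥-elim (empty B q∈B le)
      where
      empty : ∀ B {q} → q ∈ B → ¬ length B ≤ 0
      empty (_ ∷ _) _ ()
    ...       | suc N' =
      let A' , reached' , sub , closed = search N' (q ∷ A) (B without q)
                                           (≤-pred (≤-trans (without-< q∈B) le))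
                                           ((All.lookup reached u∈A ◅◅ r ◅ ε) ∷ reached)
      in A' , reached' , sub ∘ there , λ {_} {q'} u∈A' q'∈B r' → step A' sub closed u∈A' q'∈B r' (q' ≟ q)
      where
      step : ∀ A' → (∀ {u} → u ∈ q ∷ A → u ∈ A') →
             (∀ {u q'} → u ∈ A' → q' ∈ B without q → R u q' → q' ∈ A') →
             ∀ {u q'} → u ∈ A' → q' ∈ B → R u q' → Dec (q' ≡ q) → q' ∈ A'
      step A' sub closed u∈A' q'∈B r' (yes refl) = sub (here refl)
      step A' sub closed u∈A' q'∈B r' (no q'≢q) =
        closed u∈A' (∈-filter⁺ (λ u → ¬? (u ≟ q)) q'∈B q'≢q) r'

    reachable : ∀ U → ∃ λ A → All (Star R v) A × v ∈ A × (∀ {u q} → u ∈ A → q ∈ U → R u q → q ∈ A)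
    reachable U = let A , reached , sub , closed = search (length U) (v ∷ []) U ≤-refl (ε ∷ [])
                  in A , reached , sub (here refl) , closed

  -- A vertex counts as visited only when a step leaves it. The empty walk therefore visits nothing,
  -- and a closed walk that visits something can be repeated for ever.
  data Visits {R : Rel V 0ℓ} (u : V) : ∀ {a b} → Star R a b → Set where
    start : ∀ {q b} {r : R u q} {w : Star R q b} → Visits u (r ◅ w)
    later : ∀ {a q b} {r : R a q} {w : Star R q b} → Visits u w → Visits u (r ◅ w)

  visitsʳ : ∀ {R : Rel V 0ℓ} {u a b c} (w : Star R a b) {w' : Star R b c} → Visits u w' → Visits u (w ◅◅ w')
  visitsʳ ε p = p
  visitsʳ (r ◅ w) p = later (visitsʳ w p)

  Inside : Rel V 0ℓ → List V → Rel V 0ℓ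
  Inside E U u q = E u q × u ∈ U × q ∈ U

  module _ {E : Rel V 0ℓ} (E? : Decidable E) where

    Inside? : ∀ U → Decidable (Inside E U)
    Inside? U u q = E? u q ×-dec (u ∈? U) ×-dec (q ∈? U)

    -- In `split` the part `U₁` is closed under the edges inside `U`: what leaves `U₁` leaves `U`,
    -- so `U₁` can be settled alone, and it then supplies the exits from `U₂` into `U`.
    data Shape (U : List V) : Set where
      sink  : ∀ v → v ∈ U → (∀ {q} → E v q → q ∉ U) → Shape U
      split : ∀ U₁ U₂ → length U₁ < length U → length U₂ < length U →
              (∀ {u} → u ∈ U₁ → u ∈ U) → (∀ {u} → u ∈ U₂ → u ∈ U) →
              (∀ {u} → u ∈ U → u ∈ U₁ ⊎ u ∈ U₂) →
              (∀ {u q} → u ∈ U₁ → E u q → q ∈ U → q ∈ U₁) → Shape U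
      loop  : ∀ {v} (w : Star (Inside E U) v v) → v ∈ U → (∀ {u} → u ∈ U → Visits u w) → Shape U

    private
      splitAt : ∀ {U a b} {Q : V → Set} (Q? : ∀ u → Dec (Q u)) → a ∈ U → Q a → b ∈ U → ¬ Q b →
                (∀ {u q} → u ∈ U → Q u → q ∈ U → E u q → Q q) → Shape U
      splitAt {U} {Q = Q} Q? a∈U Qa b∈U ¬Qb closed =
        split (filter Q? U) (filter (¬? ∘ Q?) U)
          (filter-notAll Q? U (lose b∈U ¬Qb)) (filter-notAll (¬? ∘ Q?) U (lose a∈U λ ¬Qa → ¬Qa Qa))
          (proj₁ ∘ ∈-filter⁻ Q?) (proj₁ ∘ ∈-filter⁻ (¬? ∘ Q?))
          part
          (λ u∈U₁ r q∈U → let u∈U , Qu = ∈-filter⁻ Q? u∈U₁ in ∈-filter⁺ Q? q∈U (closed u∈U Qu q∈U r))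
        where
        part : ∀ {u} → u ∈ U → u ∈ filter Q? U ⊎ u ∈ filter (¬? ∘ Q?) U
        part {u} u∈U with Q? u
        ... | yes Qu = inj₁ (∈-filter⁺ Q? u∈U Qu)
        ... | no ¬Qu = inj₂ (∈-filter⁺ (¬? ∘ Q?) u∈U ¬Qu)

      -- One round trip from `v` is appended for each vertex `u`. The step out of `u` is taken
      -- explicitly, so that the trip visits `u` even if `u` is `v`.
      tour : ∀ {U v} → (∀ {u} → u ∈ U → ∃ λ q → Inside E U u q) →
             (∀ {u} → u ∈ U → Star (Inside E U) v u) → (∀ {u} → u ∈ U → Star (Inside E U) u v) →
             ∀ U' → (∀ {u} → u ∈ U' → u ∈ U) →
             Σ (Star (Inside E U) v v) λ w → ∀ {u} → u ∈ U' → Visits u w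
      tour next to from [] sub = ε , λ ()
      tour next to from (u ∷ U') sub =
        let q , r , u∈U , q∈U = next (sub (here refl))
            w , visits = tour next to from U' (sub ∘ there)
            out = to u∈U
            back = (r , u∈U , q∈U) ◅ from q∈U
        in out ◅◅ back ◅◅ w ,
           λ { (here refl) → visitsʳ out start
             ; (there m) → visitsʳ out (visitsʳ back (visits m)) }

    -- If there is no sink, the vertices reachable from `v` and those reaching `v` are compared with
    -- `U`. If the former miss a vertex, they form an edge-closed part; if the latter do, their
    -- complement is one; otherwise `U` is strongly connected.
    shape : ∀ U {v} → v ∈ U → Shape U
    shape U {v} v∈U with all? (λ u → any? (Inside? U u) U) U
    ... | no notAll with find (¬All⇒Any¬ (λ u → any? (Inside? U u) U) U notAll)
    ...   | u , u∈U , none = sink u u∈U λ r q∈U → none (lose q∈U (r , u∈U , q∈U))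
    shape U {v} v∈U | yes next
      with reachable (Inside? U) v U | reachable (λ a b → Inside? U b a) v U
    ... | A , to , v∈A , closed | B , from , v∈B , closed' with all? (_∈? A) U | all? (_∈? B) U
    ...   | no notAll | _ with find (¬All⇒Any¬ (_∈? A) U notAll)
    ...     | b , b∈U , b∉A = splitAt (_∈? A) v∈U v∈A b∈U b∉A
              λ u∈U u∈A q∈U r → closed u∈A q∈U (r , u∈U , q∈U)
    shape U {v} v∈U | yes next | A , to , v∈A , closed | B , from , v∈B , closed' | yes allA | no notAll
      with find (¬All⇒Any¬ (_∈? B) U notAll)
    ...     | b , b∈U , b∉B = splitAt (λ u → ¬? (u ∈? B)) b∈U b∉B v∈U (λ v∉B → v∉B v∈B)
              λ u∈U u∉B q∈U r q∈B → u∉B (closed' q∈B u∈U (r , u∈U , q∈U))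
    shape U {v} v∈U | yes next | A , to , v∈A , closed | B , from , v∈B , closed' | yes allA | yes allB =
      let w , visits = tour (λ u∈U → let q , _ , r = find (All.lookup next u∈U) in q , r)
                            (λ u∈U → All.lookup to (All.lookup allA u∈U))
                            (λ u∈U → reverse id (All.lookup from (All.lookup allB u∈U)))
                            U id
      in loop w v∈U visits

  -- run w follows w and then repeats the loop r ◅ l for ever.
  module _ {R : Rel V 0ℓ} {v q : V} (r : R v q) (l : Star R q v) where

    run : ∀ {u} → Star R u v → ℕ → V
    run {u} w zero = u
    run (_ ◅ w) (suc i) = run w i
    run ε (suc i) = run l i

    run-step : ∀ {u} (w : Star R u v) i → R (run w i) (run w (suc i))
    run-step (r' ◅ w) zero = r'
    run-step ε zero = r
    run-step (_ ◅ w) (suc i) = run-step w i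
    run-step ε (suc i) = run-step l i

    run-visits : ∀ {a u} (w : Star R a v) → Visits u w → ∃ λ i → run w i ≡ u
    run-visits _ start = 0 , refl
    run-visits (_ ◅ w) (later p) = let i , e = run-visits w p in suc i , e

    -- A tail of a run is again a run, so that recurrence beyond every index follows from a single
    -- lap.
    run-shift : ∀ {a} m (w : Star R a v) → ∃ λ a' → Σ (Star R a' v) λ w' → ∀ i → run w (m + i) ≡ run w' i
    run-shift zero w = _ , w , λ i → refl
    run-shift (suc m) (_ ◅ w) = run-shift m w
    run-shift (suc m) ε = run-shift m l

    run-loop : ∀ {a u} (w : Star R a v) → Visits u (r ◅ l) → ∃ λ i → run w i ≡ u
    run-loop (_ ◅ w) p = let i , e = run-loop w p in suc i , e
    run-loop ε start = 0 , refl
    run-loop ε (later p) = let i , e = run-visits l p in suc i , e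

    run-recurs : ∀ {a u} (w : Star R a v) → Visits u (r ◅ l) → ∀ m → ∃ λ i → m ≤ i × run w i ≡ u
    run-recurs w p m =
      let _ , w' , shift = run-shift m w
          i , e = run-loop w' p
      in m + i , m≤m+n m i , trans (shift i) e

  follow : ∀ {E : Rel V 0ℓ} {u v} → Star E u v → (ℕ → V) → ℕ → V
  follow ε f i = f i
  follow {u = u} (_ ◅ w) f zero = u
  follow (_ ◅ w) f (suc i) = follow w f i

  follow-0 : ∀ {E : Rel V 0ℓ} {u v} (w : Star E u v) f → f 0 ≡ v → follow w f 0 ≡ u
  follow-0 ε f e = e
  follow-0 (_ ◅ w) f e = refl

  follow-step : ∀ {E : Rel V 0ℓ} {u v} (w : Star E u v) f → f 0 ≡ v → (∀ i → E (f i) (f (suc i))) →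
                ∀ i → E (follow w f i) (follow w f (suc i))
  follow-step ε f e h i = h i
  follow-step {E} {u} (r ◅ w) f e h zero = subst (E u) (sym (follow-0 w f e)) r
  follow-step (r ◅ w) f e h (suc i) = follow-step w f e h i

  follow-shift : ∀ {E : Rel V 0ℓ} {u v} (w : Star E u v) f → ∃ λ k → ∀ i → follow w f (k + i) ≡ f i
  follow-shift ε f = 0 , λ i → refl
  follow-shift (_ ◅ w) f = let k , h = follow-shift w f in suc k , h

-- Cyclic proofs as graphs

Addr : Set
Addr = List ℕ

sub-++ : ∀ {c} (s : PreTree c) p q {e} → sub s p ≡ just e → sub s (p ++ q) ≡ sub (proj₂ e) q
subAll-++ : ∀ {cs} (ts : All PreTree cs) j p q {e} → subAll ts j p ≡ just e → subAll ts j (p ++ q) ≡ sub (proj₂ e) q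
sub-++ s [] q refl = refl
sub-++ (node _ ts) (j ∷ p) q eq = subAll-++ ts j p q eq
subAll-++ (s ∷ ts) zero p q eq = sub-++ s p q eq
subAll-++ (s ∷ ts) (suc j) p q eq = subAll-++ ts j p q eq

child : ∀ {cs} (ts : All PreTree cs) {j} → j < length cs → ∃ λ e → subAll ts j [] ≡ just e
child (s ∷ ts) {zero} _ = _ , refl
child (s ∷ ts) {suc j} (s≤s lt) = child ts lt

child-< : ∀ {cs} (ts : All PreTree cs) j p {e} → subAll ts j p ≡ just e → j < length cs
child-< (s ∷ ts) zero p eq = s≤s z≤n
child-< (s ∷ ts) (suc j) p eq = s≤s (child-< ts j p eq)

children : ∀ {cs} {Q : Sequent → Set} (ts : All PreTree cs) →
           (∀ j {c s} → subAll ts j [] ≡ just (c , s) → Q c) → All Q cs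
children [] f = []
children (s ∷ ts) f = f 0 refl ∷ children ts (f ∘ suc)

addrs : ∀ {c} → PreTree c → List Addr
addrsAll : ∀ {cs} → ℕ → All PreTree cs → List Addr
addrs (bud _) = [ [] ]
addrs (node _ ts) = [] ∷ addrsAll 0 ts
addrsAll j [] = []
addrsAll j (s ∷ ts) = map (j ∷_) (addrs s) ++ addrsAll (suc j) ts

∈-addrs : ∀ {c} (s : PreTree c) p {e} → sub s p ≡ just e → p ∈ addrs s
∈-addrsAll : ∀ {cs} k (ts : All PreTree cs) j p {e} → subAll ts j p ≡ just e → (k + j ∷ p) ∈ addrsAll k ts
∈-addrs (bud _) [] eq = here refl
∈-addrs (node _ ts) [] eq = here refl
∈-addrs (node _ ts) (j ∷ p) eq = there (∈-addrsAll 0 ts j p eq)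
∈-addrsAll k (s ∷ ts) zero p eq rewrite +-identityʳ k = ∈-++⁺ˡ (∈-map⁺ (k ∷_) (∈-addrs s p eq))
∈-addrsAll k (s ∷ ts) (suc j) p eq rewrite +-suc k j = ∈-++⁺ʳ (map (k ∷_) (addrs s)) (∈-addrsAll (suc k) ts j p eq)

-- Computable counterpart of `Step`: edges have to be decided in order to search the graph.
succsOf : Addr → Node → List Addr
succsOf p (_ , bud b) = [ b ]
succsOf p (_ , node {ps = cs} _ _) = map (λ j → p ++ [ j ]) (upTo (length cs))

baseVars : ∀ {c cs} → BaseRule c cs → List ℕ
baseVars (allR _ y _) = [ y ]
baseVars (exL _ y _) = [ y ]
baseVars _ = []

-- The names whose value changes between conclusion and premises.
ruleVars : ∀ {c cs} → CPARule c cs → List ℕ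
ruleVars (base r) = baseVars r
ruleVars (case y) = [ y ]

nodeVars : Node → List ℕ
nodeVars (_ , bud _) = []
nodeVars (_ , node i _) = ruleVars (Inst.rule i)

seqVars : Sequent → List ℕ
seqVars (Γ , Δ) = concatMap vars Γ ++ concatMap vars Δ

≋-sym : ∀ {S S'} → S ≋ S' → S' ≋ S
≋-sym ((a , b) , (c , d)) = (b , a) , (d , c)

FreeSeq-≋ : ∀ {x S S'} → S ≋ S' → FreeSeq x S → FreeSeq x S'
FreeSeq-≋ ((a , _) , _) (inj₁ p) = inj₁ (Any-resp-⊆ a p)
FreeSeq-≋ (_ , (c , _)) (inj₂ p) = inj₂ (Any-resp-⊆ c p)

eigenvar-notFree : ∀ {c cs y} (r : BaseRule c cs) → y ∈ baseVars r → ¬ FreeSeq y c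
eigenvar-notFree (allR _ _ h) (here refl) = h
eigenvar-notFree (exL _ _ h) (here refl) = h

-- For this reason the zero premise of a case distinction on the trace variable never lies on the
-- loop, where that variable is free everywhere.
notFree-subst0 : ∀ x S → ¬ FreeSeq x (substSeq x `0 S)
notFree-subst0 x (Γ , Δ) = [ notFree Γ , notFree Δ ]′
  where
  notFree : ∀ Γ → ¬ Any (FreeF x) (map (fsubF x `0) Γ)
  notFree (γ ∷ Γ) (here p) = notFree-fsubF x `0 γ id p
  notFree (γ ∷ Γ) (there p) = notFree Γ p

-- Soundness of single inferences under side hypotheses

module LocalSoundness (K : ℕ) where
  open Calculus K

  Holds : List (Formula 0) → Sequent → Set
  Holds Φ (Γ , Δ) = P (Γ ++ Φ) Δ

  private variable
    Φ Ψ : List (Formula 0)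

  Holds-≋ : ∀ {S S'} → S ≋ S' → Holds Φ S → Holds Φ S'
  Holds-≋ {Φ} ((a , _) , (b , _)) = weaken (++⁺ˡ Φ a) b

  Holds-⊆ : Φ ⊆ Ψ → ∀ {S} → Holds Φ S → Holds Ψ S
  Holds-⊆ h {Γ , _} = weaken (++⁺ʳ Γ h) id

  Holds-Pointwise : ∀ {Ss Ss'} → Pointwise _≋_ Ss Ss' → All (Holds Φ) Ss → All (Holds Φ) Ss'
  Holds-Pointwise [] [] = []
  Holds-Pointwise (e ∷ es) (p ∷ ps) = Holds-≋ e p ∷ Holds-Pointwise es ps

  private
    fresh-++ : ∀ {Γ Δ y} → ¬ FreeSeq y (Γ , Δ) → Fresh y Φ → ¬ FreeSeq y (Γ ++ Φ , Δ)
    fresh-++ {Γ = Γ} h f (inj₁ p) = [ h ∘ inj₁ , All.All¬⇒¬Any f ]′ (Any.++⁻ Γ p)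
    fresh-++ h f (inj₂ p) = h (inj₂ p)

    raw : ∀ {Γ Δ cs} → BaseRule (Γ , Δ) cs → All (PAProof K) cs → P Γ Δ
    raw r ps = rule r (id , id) (id , id) ps

    axiom : ∀ {Γ Δ} → BaseRule (Γ , Δ) [] → P (Γ ++ Φ) Δ
    axiom r = weaken ∈-++⁺ˡ id (raw r [])

  -- Side hypotheses at the end of the antecedent preserve the shape of every rule; only the
  -- eigenvariable conditions see them.
  baseStep : ∀ {c cs} (r : BaseRule c cs) → (∀ {y} → y ∈ baseVars r → Fresh y Φ) →
             All (Holds Φ) cs → Holds Φ c
  baseStep (ax {Γ} φ) f [] = axiom (ax {Γ} φ)
  baseStep (botL {Γ}) f [] = axiom (botL {Γ})
  baseStep (eqR {Γ} t) f [] = axiom (eqR {Γ} t)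
  baseStep (eqL {Γ} x φ s t) f [] = axiom (eqL {Γ} x φ s t)
  baseStep (andL φ ψ) f (p ∷ []) = raw (andL φ ψ) (p ∷ [])
  baseStep (andR φ ψ) f (p ∷ q ∷ []) = raw (andR φ ψ) (p ∷ q ∷ [])
  baseStep (orL φ ψ) f (p ∷ q ∷ []) = raw (orL φ ψ) (p ∷ q ∷ [])
  baseStep (orR φ ψ) f (p ∷ []) = raw (orR φ ψ) (p ∷ [])
  baseStep (impL φ ψ) f (p ∷ q ∷ []) = raw (impL φ ψ) (p ∷ q ∷ [])
  baseStep (impR φ ψ) f (p ∷ []) = raw (impR φ ψ) (p ∷ [])
  baseStep (allL φ t) f (p ∷ []) = raw (allL φ t) (p ∷ [])
  baseStep (allR φ y h) f (p ∷ []) = raw (allR φ y (fresh-++ h (f (here refl)))) (p ∷ [])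
  baseStep (exL φ y h) f (p ∷ []) = raw (exL φ y (fresh-++ h (f (here refl)))) (p ∷ [])
  baseStep (exR φ t) f (p ∷ []) = raw (exR φ t) (p ∷ [])
  baseStep {Φ} (wk {Γ} Γ' Δ') f (p ∷ []) = weaken (++⁺ˡ Φ ∈-++⁺ˡ) ∈-++⁺ˡ p
  baseStep (cut φ) f (p ∷ q ∷ []) = raw (cut φ) (p ∷ q ∷ [])
  baseStep (ar-zs t) f [] = axiom (ar-zs t)
  baseStep (ar-ss s t) f [] = axiom (ar-ss s t)
  baseStep (ar-p0 s) f [] = axiom (ar-p0 s)
  baseStep (ar-pS s t) f [] = axiom (ar-pS s t)
  baseStep (ar-m0 s) f [] = axiom (ar-m0 s)
  baseStep (ar-mS s t) f [] = axiom (ar-mS s t)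

  ruleStep : ∀ {c cs} (r : CPARule c cs) → (∀ {y} → y ∈ ruleVars r → Fresh y Φ) →
             All (Holds Φ) cs → Holds Φ c
  ruleStep (base r) f ps = baseStep r f ps
  ruleStep (case {Γ , Δ} y) f (p ∷ q ∷ []) = caseP Γ Δ y (f (here refl)) p q

  instStep : ∀ {c cs} (i : Inst CPARule c cs) → (∀ {y} → y ∈ ruleVars (Inst.rule i) → Fresh y Φ) →
             All (Holds Φ) cs → Holds Φ c
  instStep (inst _ _ r c≋ ps≋) f ps = Holds-≋ (≋-sym c≋) (ruleStep r f (Holds-Pointwise ps≋ ps))

  -- The hypothesis `g` may contain `x`, so it is treated as part of the sequent and substituted
  -- with it. The zero premise is derived without it, because it will come from an exit.
  caseGuard : ∀ {g g'} Γ Δ x → Fresh x Φ → fsubF x (`S (fv x)) g ≡ g' →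
              Holds Φ (substSeq x `0 (Γ , Δ)) → Holds (g' ∷ Φ) (substSeq x (`S (fv x)) (Γ , Δ)) →
              Holds (g ∷ Φ) (Γ , Δ)
  caseGuard {Φ} {g} Γ Δ x f refl p q = weaken from id
    (caseP (g ∷ Γ) Δ x f (weaken there id p) (weaken to id q))
    where
    to : ∀ {g Γ} → (Γ ++ g ∷ Φ) ⊆ (g ∷ Γ ++ Φ)
    to {Γ = Γ} m with ∈-++⁻ Γ m
    ... | inj₁ m' = there (∈-++⁺ˡ m')
    ... | inj₂ (here e) = here e
    ... | inj₂ (there m') = there (∈-++⁺ʳ Γ m')

    from : ∀ {g Γ} → (g ∷ Γ ++ Φ) ⊆ (Γ ++ g ∷ Φ)
    from {Γ = Γ} (here e) = ∈-++⁺ʳ Γ (here e)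
    from {Γ = Γ} (there m) = ++⁺ʳ Γ there m

isCase? : ∀ x (m : Maybe Node) → Dec (OnJust (IsCaseNode x) m)
isCase? x nothing = no λ { (_ , () , _) }
isCase? x (just (_ , bud _)) = no λ { (_ , refl , ()) }
isCase? x (just (_ , node (inst _ _ (base r) _ _) _)) = no λ { (_ , refl , ()) }
isCase? x (just (_ , node (inst _ _ (case y) _ _) _)) with x ≟ y
... | yes x≡y = yes (_ , refl , x≡y)
... | no x≢y = no λ { (_ , refl , x≡y) → x≢y x≡y }

module CyclicProof {S : Sequent} (t : PreTree S) where

  E : Addr → Addr → Set
  E p q = q ∈ maybe′ (succsOf p) [] (sub t p)

  _≟A_ : (p q : Addr) → Dec (p ≡ q)
  _≟A_ = ≡-dec _≟_

  open Graph _≟A_ public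
  open import Data.List.Membership.DecPropositional _≟A_ using (_∈?_) public

  E? : ∀ p q → Dec (E p q)
  E? p q = q ∈? _

  addrVars : Addr → List ℕ
  addrVars p = maybe′ nodeVars [] (sub t p)

  boundVars : List Addr → List ℕ
  boundVars = concatMap addrVars

  ∈-addrVars : ∀ p {e y} → sub t p ≡ just e → y ∈ nodeVars e → y ∈ addrVars p
  ∈-addrVars p eq m rewrite eq = m

  ∈-boundVars : ∀ {U p e y} → p ∈ U → sub t p ≡ just e → y ∈ nodeVars e → y ∈ boundVars U
  ∈-boundVars {p = p} p∈U eq m = ∈-concatMap⁺ addrVars (lose p∈U (∈-addrVars p eq m))

  boundVars-⊆ : ∀ {U U'} → (∀ {p} → p ∈ U' → p ∈ U) → ∀ {y} → y ∈ boundVars U' → y ∈ boundVars U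
  boundVars-⊆ {U} {U'} h m = let p , p∈U' , m' = find (∈-concatMap⁻ addrVars {xs = U'} m)
                             in ∈-concatMap⁺ addrVars (lose (h p∈U') m')

  boundVars-node : ∀ {U y} → y ∈ boundVars U → ∃ λ p → p ∈ U × OnJust (λ e → y ∈ nodeVars e) (sub t p)
  boundVars-node {U} {y} m with find (∈-concatMap⁻ addrVars {xs = U} m)
  ... | p , p∈U , m' = p , p∈U , justly (sub t p) m'
    where
    justly : ∀ m → y ∈ maybe′ nodeVars [] m → OnJust (λ e → y ∈ nodeVars e) m
    justly (just e) m = e , refl , m

  E-source : ∀ {p q} → E p q → ∃ λ e → sub t p ≡ just e × q ∈ succsOf p e
  E-source {p} h with sub t p
  ... | just e = e , refl , h

  E-bud : ∀ p {c b} → sub t p ≡ just (c , bud b) → E p b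
  E-bud p eq rewrite eq = here refl

  child-sub : ∀ p {c cs} {i : Inst CPARule c cs} {ts : All PreTree cs} → sub t p ≡ just (c , node i ts) →
              ∀ j → sub t (p ++ [ j ]) ≡ subAll ts j []
  child-sub p eq j = sub-++ t p [ j ] eq

  E-child : ∀ p {c cs} {i : Inst CPARule c cs} {ts : All PreTree cs} → sub t p ≡ just (c , node i ts) →
            ∀ {j} → j < length cs → E p (p ++ [ j ])
  E-child p eq lt rewrite eq = ∈-map⁺ (λ j → p ++ [ j ]) (∈-upTo⁺ lt)

  E⇒Step : ∀ {p q} → E p q → Step t p q
  E⇒Step {p} h with E-source {p} h
  ... | (c , bud b) , eq , here q≡b = inj₂ (_ , eq , sym q≡b)
  ... | (c , node i ts) , eq , m with ∈-map⁻ (λ j → p ++ [ j ]) m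
  ...   | j , j∈ , refl = let e , eq' = child ts (∈-upTo⁻ j∈)
                          in inj₁ (j , refl , (_ , eq , tt) , (e , trans (child-sub p eq j) eq' , tt))

  walk : ∀ a {c s} p {e} → sub t a ≡ just (c , s) → sub s p ≡ just e → Star E a (a ++ p)
  walk a [] eq _ = subst (Star E a) (sym (++-identityʳ a)) ε
  walk a {s = node i ts} (j ∷ p) eq eq' with child ts (child-< ts j p eq')
  ... | (c , s) , eq'' = E-child a eq (child-< ts j p eq') ◅
    subst (Star E (a ++ [ j ])) (++-assoc a [ j ] p)
      (walk (a ++ [ j ]) p (trans (child-sub a eq j) eq'') (trans (sym (subAll-++ ts j [] p eq'')) eq'))

  module _ (good : ∀ a → InfBranch t a → GoodBranch t a) where

    -- Repeating the loop for ever gives an infinite branch; its trace variable is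
    -- free everywhere on the loop and the loop passes a case distinction on it.
    loop-variable : ∀ {U v} (w : Star (Inside E U) v v) → v ∈ U → (∀ {u} → u ∈ U → Visits u w) →
      ∃ λ x → (∀ {u} → u ∈ U → OnJust (λ e → FreeSeq x (proj₁ e)) (sub t u)) ×
              ∃ λ u → u ∈ U × OnJust (IsCaseNode x) (sub t u)
    loop-variable {U} {v} w v∈U visits with w | visits
    ... | ε | visits with visits v∈U
    ...   | ()
    loop-variable {U} {v} w v∈U visits | r ◅ l | visits' =
      -- Every vertex of `U` recurs on the branch after `k`, so `x` is free in its sequent. The case
      -- distinction is sought beyond the prefix, where the branch stays in `U`.
      let x , k , free , often = good branch infinite
      in x , (λ u∈U → let i , k≤i , e = run-recurs r l ε (visits' u∈U) k
                      in subst (λ u → OnJust (λ e → FreeSeq x (proj₁ e)) (sub t u))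
                           (trans (proj₂ shift i) e)
                           (free (proj₁ shift + i) (≤-trans k≤i (m≤n+m i (proj₁ shift)))))
           , caseOn x (often (proj₁ shift))
      where
      f : ℕ → Addr
      f = run r l ε

      prefix : Star E [] v
      -- A vertex with an outgoing edge is the address of a node, and its address spells out a walk
      -- from the root.
      prefix with E-source {v} (proj₁ r)
      ... | e , eq , _ = walk [] v refl eq

      branch : ℕ → Addr
      branch = follow prefix f

      infinite : InfBranch t branch
      infinite = follow-0 prefix f refl ,
        λ i → E⇒Step (follow-step prefix f refl (proj₁ ∘ run-step r l ε) i)

      shift : ∃ λ k → ∀ i → branch (k + i) ≡ f i
      shift = follow-shift prefix f

      caseOn : ∀ x → (∃ λ i → proj₁ shift ≤ i × OnJust (IsCaseNode x) (sub t (branch i))) →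
               ∃ λ u → u ∈ U × OnJust (IsCaseNode x) (sub t u)
      caseOn x (i , k≤i , h) with m≤n⇒∃[o]m+o≡n k≤i
      ... | o , refl = f o , proj₁ (proj₂ (run-step r l ε o)) ,
                       subst (λ u → OnJust (IsCaseNode x) (sub t u)) (proj₂ shift o) h

-- Unravelling

module Unravel (n : ℕ) {S : Sequent} (t : PreTree S) (buds : BudsOK t)
               (good : ∀ a → InfBranch t a → GoodBranch t a)
               (budsPi : ∀ {p c b} → sub t p ≡ just (c , bud b) → AllPi n c) where
  open Calculus (suc n)
  open Prenex (suc n)
  open LocalSoundness (suc n)
  open CyclicProof t

  -- Vacuous at addresses outside the tree, so that edges need no separate check that they end at a
  -- node.
  HoldsAt : List (Formula 0) → Addr → Set
  HoldsAt Φ p = ∀ {c s} → sub t p ≡ just (c , s) → Holds Φ c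

  HoldsAt-⊆ : ∀ {Φ Ψ p} → Φ ⊆ Ψ → HoldsAt Φ p → HoldsAt Ψ p
  HoldsAt-⊆ h k {c} eq = Holds-⊆ h {c} (k eq)

  addrStep : ∀ {Φ} p → (∀ {y} → y ∈ addrVars p → Fresh y Φ) → (∀ {q} → E p q → HoldsAt Φ q) → HoldsAt Φ p
  addrStep p f h {c} {bud b} eq with buds p c b eq
  ... | (c' , node _ _) , eq' , c≋c' = Holds-≋ (≋-sym c≋c') (h (E-bud p eq) eq')
  addrStep p f h {c} {node i ts} eq = instStep i (λ m → f (∈-addrVars p eq m))
    (children ts λ j eq' → h (E-child p eq (child-< ts j [] eq')) (trans (child-sub p eq j) eq'))

  budSeq : Node → List Sequent
  budSeq (c , bud _) = [ c ]
  budSeq (_ , node _ _) = []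

  budSeqs : List Addr → List Sequent
  budSeqs = concatMap (λ p → maybe′ budSeq [] (sub t p))

  ∈-budSeqs : ∀ {U p c b} → p ∈ U → sub t p ≡ just (c , bud b) → c ∈ budSeqs U
  ∈-budSeqs {p = p} {c} p∈U eq = ∈-concatMap⁺ _ (lose p∈U this)
    where
    this : c ∈ maybe′ budSeq [] (sub t p)
    this rewrite eq = here refl

  budSeqs-bud : ∀ {U c} → c ∈ budSeqs U → ∃ λ p → p ∈ U × ∃ λ b → sub t p ≡ just (c , bud b)
  budSeqs-bud {U} {c} m with find (∈-concatMap⁻ (λ p → maybe′ budSeq [] (sub t p)) {xs = U} m)
  ... | p , p∈U , m' = let b , eq = isBud (sub t p) m' in p , p∈U , b , eq
    where
    isBud : ∀ r → c ∈ maybe′ budSeq [] r → ∃ λ b → r ≡ just (c , bud b)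
    isBud (just (_ , bud b)) (here refl) = b , refl

  treeVars : List ℕ
  treeVars = concatMap (λ p → maybe′ (seqVars ∘ proj₁) [] (sub t p)) (addrs t)

  treeVars-fresh : ∀ {y p c s} → y ∉ treeVars → sub t p ≡ just (c , s) → Fresh y (proj₁ c) × Fresh y (proj₂ c)
  treeVars-fresh {y} {p} {c} h eq =
    notIn-vars (proj₁ c) (h ∘ into ∘ ∈-++⁺ˡ) , notIn-vars (proj₂ c) (h ∘ into ∘ ∈-++⁺ʳ (concatMap vars (proj₁ c)))
    where
    this : y ∈ seqVars c → y ∈ maybe′ (seqVars ∘ proj₁) [] (sub t p)
    this m rewrite eq = m

    into : y ∈ seqVars c → y ∈ treeVars
    into m = ∈-concatMap⁺ _ (lose (∈-addrs t p eq) (this m))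

  Safe : List Addr → List (Formula 0) → Set
  Safe U Φ = ∀ {y} → y ∈ boundVars U → Fresh y Φ

  Exits : List Addr → List (Formula 0) → Set
  Exits U Φ = ∀ {p q} → p ∈ U → E p q → q ∉ U → HoldsAt Φ q

  -- Induction on the bound of the trace variable

  module Loop (U : List Addr) (Φ : List (Formula 0)) (safe : Safe U Φ) (exits : Exits U Φ)
              (x : ℕ) (x-free : ∀ {p c s} → p ∈ U → sub t p ≡ just (c , s) → FreeSeq x c)
              (x∈ : x ∈ boundVars U)
              (z : ℕ) (z∉ : z ∉ boundVars U ++ concatMap vars Φ ++ treeVars)
              (a : ℕ) (a∉ : a ∉ z ∷ boundVars U ++ concatMap vars Φ ++ treeVars) where

    -- x < a and x ≤ a, with z as witness.
    below upto : Formula 0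
    below = `S (fv z `+ fv x) ≐ fv a
    upto = (fv z `+ fv x) ≐ fv a

    z∉Φ : Fresh z Φ
    z∉Φ = notIn-vars Φ (z∉ ∘ ∈-++⁺ʳ (boundVars U) ∘ ∈-++⁺ˡ)

    a∉Φ : Fresh a Φ
    a∉Φ = notIn-vars Φ (a∉ ∘ there ∘ ∈-++⁺ʳ (boundVars U) ∘ ∈-++⁺ˡ)

    z∉t : z ∉ treeVars
    z∉t = z∉ ∘ ∈-++⁺ʳ (boundVars U) ∘ ∈-++⁺ʳ (concatMap vars Φ)

    a∉t : a ∉ treeVars
    a∉t = a∉ ∘ there ∘ ∈-++⁺ʳ (boundVars U) ∘ ∈-++⁺ʳ (concatMap vars Φ)

    ≢z : ∀ {y} → y ∈ boundVars U → y ≢ z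
    ≢z m refl = z∉ (∈-++⁺ˡ m)

    ≢a : ∀ {y} → y ∈ boundVars U → y ≢ a
    ≢a m refl = a∉ (there (∈-++⁺ˡ m))

    a≢z : a ≢ z
    a≢z refl = a∉ (here refl)

    zs : List ℕ
    zs = z ∷ boundVars U

    -- The existential quantifier hidden in `x < a` becomes the universal one over `z` in front of
    -- the implication, which leaves an equation as guard.
    guarded : Sequent → Sequent
    guarded (Γ , Δ) = below ∷ Γ , Δ

    Ss : List Sequent
    Ss = map guarded (budSeqs U)

    Ss-Pi : All (AllPi n) Ss
    Ss-Pi = All.map⁺ (All.tabulate λ m →
      let p , _ , _ , eq = budSeqs-bud {U} m
          πΓ , πΔ = budsPi {p} eq
      in Delta0⇒Pi n (d-eq _ _) ∷ πΓ , πΔ)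

    -- The induction formula: for all x < a and all values of the other names
    -- that change in U, the bud sequents of U hold.
    closure : _
    closure = closure-Pi zs Ss Ss-Pi

    I : Formula 0
    I = proj₁ closure

    I-Pi : Pi (suc n) I
    I-Pi = proj₁ (proj₂ closure)

    I-notFree : ∀ {y} → y ∈ zs → ¬ FreeF y I
    I-notFree = proj₁ (proj₂ (proj₂ closure))

    I-elim : ∀ {p c b} → p ∈ U → sub t p ≡ just (c , bud b) → P (I ∷ below ∷ proj₁ c) (proj₂ c)
    I-elim p∈U eq = proj₁ (proj₂ (proj₂ (proj₂ closure))) (∈-map⁺ guarded (∈-budSeqs {U} p∈U eq))

    I-intro : ∀ {Θ} → (∀ {y} → y ∈ zs → Fresh y Θ) →
              (∀ {p c s} → p ∈ U → sub t p ≡ just (c , s) → P (below ∷ proj₁ c ++ Θ) (proj₂ c)) → P Θ [ I ]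
    I-intro h k = proj₂ (proj₂ (proj₂ (proj₂ closure))) h λ m → prem (∈-map⁻ guarded m)
      where
      prem : ∀ {S} → (∃ λ c → c ∈ budSeqs U × S ≡ guarded c) → P (proj₁ S ++ _) (proj₂ S)
      prem (c , m , refl) = let _ , p∈U , _ , eq = budSeqs-bud {U} m in k p∈U eq

    fresh-below : ∀ {y} → y ∈ boundVars U → y ≢ x → Fresh y (below ∷ I ∷ Φ)
    fresh-below m y≢x =
      (λ { (inj₁ (inj₁ e)) → ≢z m e ; (inj₁ (inj₂ e)) → y≢x e ; (inj₂ e) → ≢a m e }) ∷
      I-notFree (there m) ∷ safe m

    fresh-upto : ∀ {y} → y ∈ boundVars U → y ≢ x → Fresh y (upto ∷ I ∷ Φ)
    fresh-upto m y≢x =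
      (λ { (inj₁ (inj₁ e)) → ≢z m e ; (inj₁ (inj₂ e)) → y≢x e ; (inj₂ e) → ≢a m e }) ∷
      I-notFree (there m) ∷ safe m

    x∉IΦ : Fresh x (I ∷ Φ)
    x∉IΦ = I-notFree (there x∈) ∷ safe x∈

    replaceHyp : ∀ {A B Ψ} c → P (B ∷ Ψ) [ A ] → Holds (A ∷ Ψ) c → Holds (B ∷ Ψ) c
    replaceHyp {A} {B} {Ψ} (Γ , Δ) p q = cut₁ (weaken (∈-++⁺ʳ Γ) id p)
      (weaken perm id q)
      where
      perm : (Γ ++ A ∷ Ψ) ⊆ (A ∷ Γ ++ B ∷ Ψ)
      perm m with ∈-++⁻ Γ m
      ... | inj₁ m' = there (∈-++⁺ˡ m')
      ... | inj₂ (here e) = here e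
      ... | inj₂ (there m') = there (∈-++⁺ʳ Γ (there m'))

    below-suc below-suc′ upto-suc : Formula 0
    below-suc = `S (fv z `+ `S (fv x)) ≐ fv a
    below-suc′ = `S (`S (fv z) `+ fv x) ≐ fv a
    upto-suc = (fv z `+ `S (fv x)) ≐ fv a

    -- The names `z` and `a` avoid all sequents of the tree, so substituting for them changes the
    -- hypotheses and nothing else.
    substHyps : ∀ {y p c s} u Ψ → y ∉ treeVars → sub t p ≡ just (c , s) → Holds Ψ c →
                Holds (map (fsubF y u) Ψ) c
    substHyps {y} {p} {Γ , Δ} u Ψ y∉ eq h =
      let f , g = treeVars-fresh {p = p} y∉ eq in
      subst₂ P (trans (map-++ (fsubF y u) Γ Ψ) (cong (_++ map (fsubF y u) Ψ) (map-fsubF-fresh u f)))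
               (map-fsubF-fresh u g) (substP y u h)

    -- If x + 1 < a with witness z then x < a with witness z + 1.
    right-below : ∀ {p c s} → sub t p ≡ just (c , s) → Holds (below ∷ I ∷ Φ) c → Holds (below-suc ∷ I ∷ Φ) c
    right-below {p} {c} eq h = replaceHyp {A = below-suc′} c
      (transE _ _ _ (congS _ _ (transE _ _ _ (S-plus z (fv x)) (symE _ _ (plusS (fv z) (fv x)))))
                    (axP (here refl) (here refl)))
      (subst (λ Ψ → Holds Ψ c)
        (cong₂ _∷_ (cong₂ _≐_ (cong `S (cong₂ _`+_ (fsubT-hit₀ z (`S (fv z)))
                                                   (fsub1-≢ z (`S (fv z)) x (≢z x∈ ∘ sym))))
                              (fsub1-≢ z (`S (fv z)) a (a≢z ∘ sym)))
                   (map-fsubF-fresh (`S (fv z)) (I-notFree (here refl) ∷ z∉Φ)))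
        (substHyps {p = p} (`S (fv z)) (below ∷ I ∷ Φ) z∉t eq h))

    right-upto : ∀ c → Holds (below ∷ I ∷ Φ) c → Holds (upto-suc ∷ I ∷ Φ) c
    right-upto c = replaceHyp {A = below} c
      (transE _ _ _ (symE _ _ (plusS (fv z) (fv x))) (axP (here refl) (here refl)))

    fsub-sum : ∀ (u : Term 0) → fsubT x u (fv z `+ fv x) ≡ (fv z `+ u)
    fsub-sum u = cong₂ _`+_ (fsub1-≢ x u z (≢z x∈)) (fsubT-hit₀ x u)

    fsub-a : ∀ (u : Term 0) → fsubT x u (fv a) ≡ fv {0} a
    fsub-a u = fsub1-≢ x u a (≢a x∈)

    -- An eigenvariable is not free in its conclusion, whereas `x` is free in every sequent of `U`.
    -- Hence only case distinctions on `x` can disturb the bounds on `x`.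
    eigenvar-≢x : ∀ {p c c' cs s} (r : BaseRule c' cs) → p ∈ U → sub t p ≡ just (c , s) → c ≋ c' →
                  ∀ {y} → y ∈ baseVars r → y ≢ x
    eigenvar-≢x {p} r p∈U eq c≋ m refl = eigenvar-notFree r m (FreeSeq-≋ c≋ (x-free {p} p∈U eq))

    left-premise : ∀ {p c l r c' i} {tl : PreTree l} {tr : PreTree r} → p ∈ U →
                   sub t p ≡ just (c , node {ps = l ∷ r ∷ []} i (tl ∷ tr ∷ [])) →
                   l ≋ substSeq x `0 c' → Holds Φ l
    left-premise {p} {c' = c'} p∈U eq l≋ = exits p∈U (E-child p eq (s≤s z≤n))
      (λ q∈U → notFree-subst0 x c' (FreeSeq-≋ l≋ (x-free q∈U (child-sub p eq 0)))) (child-sub p eq 0)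

    -- The recursion follows the tree and never continues from a bud to its companion, so it is
    -- structural. It stops at buds, by `I`, and at subtrees outside `U`, by `exits`.
    descend : ∀ {c} (s : PreTree c) p → sub t p ≡ just (c , s) → p ∈ U → Holds (below ∷ I ∷ Φ) c
    -- The addresses of the children are given by a function `q`, so that the recursion along the
    -- list of premises can shift the index.
    descendAll : ∀ {cs} (ts : All PreTree cs) (q : ℕ → Addr) →
                 (∀ j {c s} → subAll ts j [] ≡ just (c , s) → sub t (q j) ≡ just (c , s)) →
                 (∀ j → j < length cs → q j ∉ U → HoldsAt Φ (q j)) → All (Holds (below ∷ I ∷ Φ)) cs
    descendNode : ∀ {c cs} (i : Inst CPARule c cs) (ts : All PreTree cs) p → sub t p ≡ just (c , node i ts) →
                  p ∈ U → All (Holds (below ∷ I ∷ Φ)) cs → Holds (below ∷ I ∷ Φ) c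
    descend {c} (bud b) p eq p∈U = weaken perm id (I-elim p∈U eq)
      where
      perm : (I ∷ below ∷ proj₁ c) ⊆ (proj₁ c ++ below ∷ I ∷ Φ)
      perm (here e) = ∈-++⁺ʳ (proj₁ c) (there (here e))
      perm (there (here e)) = ∈-++⁺ʳ (proj₁ c) (here e)
      perm (there (there m)) = ∈-++⁺ˡ m
    descend (node i ts) p eq p∈U = descendNode i ts p eq p∈U
      (descendAll ts (λ j → p ++ [ j ]) (λ j eq' → trans (child-sub p eq j) eq')
                  (λ j lt → exits p∈U (E-child p eq lt)))
    descendAll [] q sub≡ ex = []
    descendAll (_∷_ {x = c} s ts) q sub≡ ex = first (q 0 ∈? U) ∷
      descendAll ts (q ∘ suc) (λ j → sub≡ (suc j)) (λ j lt → ex (suc j) (s≤s lt))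
      where
      first : Dec (q 0 ∈ U) → Holds (below ∷ I ∷ Φ) c
      first (yes q∈U) = descend s (q 0) (sub≡ 0 refl) q∈U
      first (no q∉U) = Holds-⊆ (there ∘ there) {c} (ex 0 (s≤s z≤n) q∉U (sub≡ 0 refl))
    descendNode (inst c' ps' (base r) c≋ ps≋) ts p eq p∈U ps =
      instStep (inst c' ps' (base r) c≋ ps≋)
        (λ m → fresh-below (∈-boundVars {U} p∈U eq m) (eigenvar-≢x {p} r p∈U eq c≋ m)) ps
    descendNode (inst c' ps' (case y) c≋ ps≋) ts p eq p∈U ps with x ≟ y
    ... | no x≢y = instStep (inst c' ps' (case y) c≋ ps≋)
        (λ { (here refl) → fresh-below (∈-boundVars {U} p∈U eq (here refl)) (x≢y ∘ sym) }) ps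
    descendNode {c} (inst (Γ , Δ) _ (case _) c≋ (l≋ ∷ r≋ ∷ [])) (tl ∷ tr ∷ []) p eq p∈U (_ ∷ pr ∷ [])
        | yes refl =
      Holds-≋ (≋-sym c≋) (caseGuard Γ Δ x x∉IΦ (cong₂ _≐_ (cong `S (fsub-sum _)) (fsub-a _))
        (Holds-≋ l≋ (Holds-⊆ there {_} (left-premise {c' = Γ , Δ} p∈U eq l≋)))
        (Holds-≋ r≋ (right-below {p ++ [ 1 ]} (child-sub p eq 1) pr)))

    -- The weak bound holds at the conclusion. In the successor premise it reads `x + 1 ≤ a`, which
    -- is the strict bound that `descend` needs.
    case-upto : ∀ p → p ∈ U → OnJust (IsCaseNode x) (sub t p) → HoldsAt (upto ∷ I ∷ Φ) p
    case-upto p p∈U (_ , eq , isCase) eq' with trans (sym eq) eq'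
    case-upto p p∈U ((c , node (inst (Γ , Δ) _ (case _) c≋ (l≋ ∷ r≋ ∷ [])) (tl ∷ tr ∷ [])) , eq , refl) eq' | refl
      with descendAll (tl ∷ tr ∷ []) (λ j → p ++ [ j ]) (λ j e → trans (child-sub p eq j) e)
                      (λ j lt → exits p∈U (E-child p eq lt))
    ... | _ ∷ pr ∷ [] =
      Holds-≋ (≋-sym c≋) (caseGuard Γ Δ x x∉IΦ (cong₂ _≐_ (fsub-sum _) (fsub-a _))
        (Holds-≋ l≋ (Holds-⊆ there {_} (left-premise {c' = Γ , Δ} p∈U eq l≋)))
        (Holds-≋ r≋ (right-upto _ pr)))

    rest : List Addr
    rest = filter (λ p → ¬? (isCase? x (sub t p))) U

    rest-⊆ : ∀ {p} → p ∈ rest → p ∈ U × ¬ OnJust (IsCaseNode x) (sub t p)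
    rest-⊆ = ∈-filter⁻ (λ p → ¬? (isCase? x (sub t p))) {xs = U}

    -- The formula `upto` contains `x`, so it is admissible as a hypothesis only because the
    -- vertices that rebind `x` have been removed.
    rest-safe : Safe rest (upto ∷ I ∷ Φ)
    rest-safe {y} m with boundVars-node {rest} m
    ... | p , p∈ , e , eq , y∈e = fresh-upto (∈-boundVars {U} p∈U eq y∈e) (≢x e eq y∈e)
      where
      p∈U = proj₁ (rest-⊆ p∈)

      ≢x : ∀ e → sub t p ≡ just e → y ∈ nodeVars e → y ≢ x
      ≢x (_ , node (inst _ _ (base r) c≋ _) _) eq m = eigenvar-≢x {p} r p∈U eq c≋ m
      ≢x (_ , node (inst _ _ (case _) _ _) _) eq (here refl) refl = proj₂ (rest-⊆ p∈) (_ , eq , refl)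

    rest-exits : Exits rest (upto ∷ I ∷ Φ)
    rest-exits {p} {q} p∈ e q∉ with q ∈? U
    ... | no q∉U = HoldsAt-⊆ {p = q} (there ∘ there) (exits (proj₁ (rest-⊆ p∈)) e q∉U)
    ... | yes q∈U with isCase? x (sub t q)
    ...   | yes isCase = case-upto q q∈U isCase
    ...   | no notCase = ⊥-elim (q∉ (∈-filter⁺ (λ p → ¬? (isCase? x (sub t p))) q∈U notCase))

    module _ (hyp : ∀ {p} → p ∈ rest → HoldsAt (upto ∷ I ∷ Φ) p) where

      all-upto : ∀ {p} → p ∈ U → HoldsAt (upto ∷ I ∷ Φ) p
      all-upto {p} p∈U with isCase? x (sub t p)
      ... | yes isCase = case-upto p p∈U isCase
      ... | no notCase = hyp (∈-filter⁺ (λ p → ¬? (isCase? x (sub t p))) p∈U notCase)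

      private
        b : ℕ
        b = proj₁ (fresh (a ∷ zs ++ vars I ++ concatMap vars Φ))

        b∉ : b ∉ a ∷ zs ++ vars I ++ concatMap vars Φ
        b∉ = proj₂ (fresh (a ∷ zs ++ vars I ++ concatMap vars Φ))

        b∉I : ¬ FreeF b I
        b∉I = b∉ ∘ there ∘ ∈-++⁺ʳ zs ∘ ∈-++⁺ˡ ∘ FreeF⇒∈ I

        b∉Φ : Fresh b Φ
        b∉Φ = notIn-vars Φ (b∉ ∘ there ∘ ∈-++⁺ʳ zs ∘ ∈-++⁺ʳ (vars I))

        a≢b : a ≢ b
        a≢b e = b∉ (here (sym e))

        zs-fresh : ∀ {y} → y ∈ zs → Fresh y Φ × y ≢ a × y ≢ b
        zs-fresh (here refl) = z∉Φ , a≢z ∘ sym , λ { e → b∉ (there (here (sym e))) }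
        zs-fresh (there m) = safe m , ≢a m , λ { e → b∉ (there (there (∈-++⁺ˡ (subst (_∈ _) e m)))) }

        I[b] : Formula 0
        I[b] = fsubF a (fv b) I

        a∉I[b] : ¬ FreeF a I[b]
        a∉I[b] = notFree-fsubF a (fv b) I a≢b

        -- `I` is derived under the hypothesis `a = 0`, and `0` is substituted for `a` afterwards;
        -- thus the substitution into the prenex formula never has to be computed. The guard
        -- contradicts that hypothesis.
        base-case : P Φ [ fsubF a `0 I ]
        base-case = cut₁ (reflE `0)
          (subst (λ Ψ → P Ψ [ fsubF a `0 I ])
            (cong₂ _∷_ (cong (_≐ `0) (fsubT-hit₀ a `0)) (map-fsubF-fresh `0 a∉Φ))
            (substP a `0 (I-intro {fv a ≐ `0 ∷ Φ}
              (λ m → let f , ≢a , _ = zs-fresh m in (λ { (inj₁ e) → ≢a e }) ∷ f)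
              (λ {_} {c} _ _ → S≢0 (fv z `+ fv x) (transE _ (fv a) _ (axP (here refl) (here refl))
                (axP (there (∈-++⁺ʳ (proj₁ c) (here refl))) (here refl)))))))

        -- If `a = S b`, the guard `S (z + x) = a` gives `z + x = b`, which is `upto` with `b` for
        -- `a`; so `all-upto` is used at `b`, where its hypothesis `I` is the induction hypothesis.
        step-prem : ∀ {p c s} → p ∈ U → sub t p ≡ just (c , s) →
                    P (below ∷ proj₁ c ++ fv a ≐ `S (fv b) ∷ I[b] ∷ Φ) (proj₂ c)
        step-prem {p} {c} p∈U eq = cut₁
          (S-inj (fv z `+ fv x) (fv b) (transE _ (fv a) _ (axP (here refl) (here refl))
            (axP (there (∈-++⁺ʳ (proj₁ c) (here refl))) (here refl))))
          (weaken perm id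
            (subst (λ Ψ → Holds Ψ c)
              (cong₂ _∷_ (cong₂ _≐_ (cong₂ _`+_ (fsub1-≢ a (fv b) z a≢z) (fsub1-≢ a (fv b) x (≢a x∈ ∘ sym)))
                                    (fsubT-hit₀ a (fv b)))
                         (cong (I[b] ∷_) (map-fsubF-fresh (fv b) a∉Φ)))
              (substHyps {p = p} (fv b) (upto ∷ I ∷ Φ) a∉t eq (all-upto p∈U eq))))
          where
          perm : ∀ {H A B} → (proj₁ c ++ H ∷ I[b] ∷ Φ) ⊆ (H ∷ A ∷ proj₁ c ++ B ∷ I[b] ∷ Φ)
          perm m with ∈-++⁻ (proj₁ c) m
          ... | inj₁ m' = there (there (∈-++⁺ˡ m'))
          ... | inj₂ (here e) = here e
          ... | inj₂ (there m') = there (there (∈-++⁺ʳ (proj₁ c) (there m')))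

        step-case : P (I[b] ∷ Φ) [ fsubF a (`S (fv b)) I ]
        step-case = cut₁ (reflE (`S (fv b)))
          (subst (λ Ψ → P Ψ [ fsubF a (`S (fv b)) I ])
            (cong₂ _∷_ (cong₂ _≐_ (fsubT-hit₀ a (`S (fv b))) (cong `S (fsub1-≢ a (`S (fv b)) b a≢b)))
                       (map-fsubF-fresh (`S (fv b)) (a∉I[b] ∷ a∉Φ)))
            (substP a (`S (fv b)) (I-intro {fv a ≐ `S (fv b) ∷ I[b] ∷ Φ}
              (λ m → let f , ≢a , ≢b = zs-fresh m in
                (λ { (inj₁ e) → ≢a e ; (inj₂ e) → ≢b e }) ∷
                [ I-notFree m , ≢b ]′ ∘ FreeF-fsubF a (fv b) I ∷ f)
              step-prem)))

      -- Choosing `z + x` for `a` makes `upto` an instance of reflexivity and leaves only `I` at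
      -- this term, which the induction provides.
      conclude : ∀ {p} → p ∈ U → HoldsAt Φ p
      conclude {p} p∈U {c} eq =
        cut₁ (weaken (∈-++⁺ʳ (proj₁ c)) id (induction a b I u I-Pi b∉Φ b∉I base-case step-case))
        (cut₁ (reflE u)
          (weaken perm id
            (subst (λ Ψ → Holds Ψ c)
              (cong₂ _∷_ (cong₂ _≐_ (cong₂ _`+_ (fsub1-≢ a u z a≢z) (fsub1-≢ a u x (≢a x∈ ∘ sym)))
                                    (fsubT-hit₀ a u))
                         (cong (fsubF a u I ∷_) (map-fsubF-fresh u a∉Φ)))
              (substHyps {p = p} u (upto ∷ I ∷ Φ) a∉t eq (all-upto p∈U eq)))))
        where
        u : Term 0
        u = fv z `+ fv x

        perm : ∀ {A B} → (proj₁ c ++ A ∷ B ∷ Φ) ⊆ (A ∷ B ∷ proj₁ c ++ Φ)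
        perm m with ∈-++⁻ (proj₁ c) m
        ... | inj₁ m' = there (there (∈-++⁺ˡ m'))
        ... | inj₂ (here e) = here e
        ... | inj₂ (there (here e)) = there (here e)
        ... | inj₂ (there (there m')) = there (there (∈-++⁺ʳ (proj₁ c) m'))

  -- `N` bounds the size of `U`, since the smaller sets are not structurally smaller. `Φ` varies
  -- because a loop recurses under two further hypotheses.
  claim : ∀ N U Φ → length U ≤ N → Safe U Φ → Exits U Φ → ∀ {v} → v ∈ U → HoldsAt Φ v
  claim N U Φ le safe exits {v} v∈U with shape E? U v∈U
  claim zero (_ ∷ _) Φ () safe exits v∈U | _
  -- All successors of a sink are exits, so one inference settles it; it is then an exit of the
  -- remaining set.
  claim (suc N) U Φ le safe exits {v} v∈U | sink u u∈U none = result (v ≟A u)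
    where
    hu : HoldsAt Φ u
    hu = addrStep u (λ m → safe (∈-concatMap⁺ addrVars (lose u∈U m))) (λ e → exits u∈U e (none e))

    U' = U without u

    U'⊆U : ∀ {p} → p ∈ U' → p ∈ U
    U'⊆U m = proj₁ (∈-filter⁻ (λ p → ¬? (p ≟A u)) {xs = U} m)

    exits' : Exits U' Φ
    exits' {q = q} m e q∉ with q ≟A u | q ∈? U
    ... | yes refl | _ = hu
    ... | no q≢u | yes q∈U = ⊥-elim (q∉ (∈-filter⁺ (λ p → ¬? (p ≟A u)) q∈U q≢u))
    ... | no q≢u | no q∉U = exits (U'⊆U m) e q∉U

    result : Dec (v ≡ u) → HoldsAt Φ v
    result (yes refl) = hu
    result (no v≢u) = claim N U' Φ (≤-pred (≤-trans (without-< u∈U) le))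
      (safe ∘ boundVars-⊆ {U} {U'} U'⊆U) exits' (∈-filter⁺ (λ p → ¬? (p ≟A u)) v∈U v≢u)
  claim (suc N) U Φ le safe exits {v} v∈U | split U₁ U₂ lt₁ lt₂ sub₁ sub₂ part closed =
    [ first , second ]′ (part v∈U)
    where
    first : ∀ {p} → p ∈ U₁ → HoldsAt Φ p
    first = claim N U₁ Φ (≤-pred (≤-trans lt₁ le)) (safe ∘ boundVars-⊆ {U} {U₁} sub₁)
      (λ m e q∉ → exits (sub₁ m) e (q∉ ∘ closed m e))

    exits₂ : Exits U₂ Φ
    exits₂ {q = q} m e q∉ with q ∈? U
    ... | no q∉U = exits (sub₂ m) e q∉U
    ... | yes q∈U = [ first , ⊥-elim ∘ q∉ ]′ (part q∈U)

    second : ∀ {p} → p ∈ U₂ → HoldsAt Φ p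
    second = claim N U₂ Φ (≤-pred (≤-trans lt₂ le)) (safe ∘ boundVars-⊆ {U} {U₂} sub₂) exits₂
  claim (suc N) U Φ le safe exits {v} v∈U | loop w u∈U visits with loop-variable good w u∈U visits
  ... | x , x-free , p₀ , p₀∈U , case₀ =
    L.conclude (claim N L.rest (L.upto ∷ L.I ∷ Φ) (≤-pred (≤-trans shorter le)) L.rest-safe L.rest-exits) v∈U
    where
    x-free' : ∀ {p c s} → p ∈ U → sub t p ≡ just (c , s) → FreeSeq x c
    x-free' p∈U eq with x-free p∈U
    ... | e , eq' , free with trans (sym eq') eq
    ...   | refl = free

    x∈ : x ∈ boundVars U
    x∈ = case-var case₀
      where
      case-var : OnJust (IsCaseNode x) (sub t p₀) → x ∈ boundVars U
      case-var ((_ , node (inst _ _ (case _) _ _) _) , eq , refl) = ∈-boundVars {U} {p₀} p₀∈U eq (here refl)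

    names : List ℕ
    names = boundVars U ++ concatMap vars Φ ++ treeVars

    z = fresh names
    a = fresh (proj₁ z ∷ names)

    module L = Loop U Φ safe exits x x-free' x∈ (proj₁ z) (proj₂ z) (proj₁ a) (proj₂ a)

    shorter : length L.rest < length U
    shorter = filter-notAll (λ p → ¬? (isCase? x (sub t p))) U (lose p₀∈U λ notCase → notCase case₀)

  -- For the set of all addresses there are no exits to settle, and with no hypotheses every name is
  -- safe.
  root : PAProof (suc n) S
  root = weaken perm id (claim _ (addrs t) [] ≤-refl (λ _ → []) noExits (∈-addrs t [] refl) refl)
    where
    perm : (proj₁ S ++ []) ⊆ proj₁ S
    perm m = subst (_ ∈_) (++-identityʳ (proj₁ S)) m

    noExits : Exits (addrs t) []
    noExits {q = q} _ _ q∉ eq = ⊥-elim (q∉ (∈-addrs t q eq))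

theorem6p6 : (n : ℕ) (S : Sequent) (π : CPAProof S) →
    BudsCompanionsPi n π → PAProof (suc n) S
theorem6p6 n S (t , buds , good) budsPi = Unravel.root n t buds good λ {p} {c} {b} eq → proj₁ (budsPi p c b eq)
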